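{- For every $\gamma>0$ there exists $M_0$ such that for every integer $M\ge M_0$ there is a sporadic task set ${\bf T}$ with constrained deadlines ($D_i\le T_i$) such that, for each of the two per-processor tests below, the deadline-monotonic partitioning algorithm with $M$ unit-speed processors returns failure on ${\bf T}$ for some fitting strategy (some sequence of choices among processors passing the test), while $\Lambda({\bf T})\le W(0.5)+\gamma$: (i) time-demand analysis: $\tau_k$ can be added to processor $m$ holding ${\bf T}_m$ iff there is $t\in(0,D_k]$ with $C_k+\sum_{\tau_i\in{\bf T}_m}\lceil t/T_i\rceil C_i\le t$; (ii) hyperbolic test: $\big(\frac{C_k+\sum_{\tau_i\in{\bf T}_m,T_i\ge D_k}C_i}{D_k}+1\big)\prod_{\tau_j\in{\bf T}_m,T_j<D_k}(U_j+1)\le2$. In particular, under an arbitrary fitting strategy the speedup factor of the algorithm with either test, as measured against $\Lambda$, is at least $\frac{1}{W(0.5)}\approx2.84306$ when $M$ is sufficiently large.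
   Context: $W$ denotes the Lambert W function: $W(z)$ is the real solution $w\ge0$ of $z=we^{w}$. A sporadic task $\tau_i=(C_i,T_i,D_i)$ has worst-case execution time $C_i>0$, minimum inter-arrival time $T_i>0$ ($T_i=\infty$ allowed, meaning at most one job, with $U_i=0$), relative deadline $D_i>0$; consecutive job releases are at least $T_i$ apart and each job must complete within $D_i$ of its release. $U_i=C_i/T_i$, $\Delta_i=\max\{U_i,C_i/D_i\}$, $\mathrm{dbf}(\tau_i,t)=\max\{0,\lfloor (t-D_i)/T_i\rfloor+1\}\cdot C_i$. For $M$ processors, $$\Lambda({\bf T})=\max\Big\{\sup_{t>0}\frac{\sum_{\tau_i\in{\bf T}}\mathrm{dbf}(\tau_i,t)}{Mt},\ \frac{\sum_{\tau_i\in{\bf T}}U_i}{M},\ \max_{\tau_i\in{\bf T}}\Delta_i\Big\};$$ no multiprocessor scheduling algorithm can schedule ${\bf T}$ on $M$ processors of speed $s<\Lambda({\bf T})$. Deadline-monotonic partitioning algorithm: tasks indexed by non-decreasing relative deadline; ${\bf T}_1=\{\tau_1\}$, ${\bf T}_m=\emptyset$ for $m\ge2$; for $k=2,\dots,N$, if some processor $m$ has ${\bf T}_m\cup\{\tau_k\}$ passing the test, choose one such $m$ by the fitting strategy and add $\tau_k$ to ${\bf T}_m$, else return failure. -}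

module Defs where

open import Data.Bool using (Bool; true; false; if_then_else_)
open import Data.Nat as ℕ using (ℕ; zero; suc; NonZero)
open import Data.Integer as ℤ using (ℤ)
open import Data.Rational
  using (ℚ; 0ℚ; 1ℚ; ½; _+_; _*_; _-_; _÷_; _⊔_; _≤_; _<_; _≤ᵇ_; floor; ceiling; >-nonZero)
  renaming (_/_ to _//_)
open import Data.Fin using (Fin)
import Data.Fin as Fin
open import Data.List using (List; []; _∷_; map; foldr; _++_; [_])
open import Data.List.Relation.Unary.All using (All)
open import Data.List.Relation.Unary.Linked using (Linked)
open import Data.Vec.Functional using (Vector; updateAt)
open import Data.Sum using (_⊎_)
open import Data.Product using (Σ; _×_)
open import Data.Unit using (⊤)
open import Data.Empty using (⊥)
open import Relation.Nullary using (¬_)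

div : ℚ → (q : ℚ) → 0ℚ < q → ℚ
div p q h = _÷_ p q {{>-nonZero h}}

ℤ→ℚ : ℤ → ℚ
ℤ→ℚ z = z // 1

-- minimum inter-arrival time: a positive rational, or ∞ (at most one job)
data Period : Set where
  fin : (p : ℚ) → 0ℚ < p → Period
  ∞   : Period

record Task : Set where
  constructor task
  field
    C   : ℚ
    T   : Period
    D   : ℚ
    C>0 : 0ℚ < C
    D>0 : 0ℚ < D
open Task public

sumQ : List ℚ → ℚ
sumQ = foldr _+_ 0ℚ

prodQ : List ℚ → ℚ
prodQ = foldr _*_ 1ℚ

U : Task → ℚ
U τ with T τ
... | fin p h = div (C τ) p h
... | ∞       = 0ℚ

Δ : Task → ℚ
Δ τ = U τ ⊔ div (C τ) (D τ) (D>0 τ)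

dbf : Task → ℚ → ℚ
dbf τ t with T τ
... | fin p h = (ℤ→ℚ (floor (div (t - D τ) p h) ℤ.+ ℤ.+ 1) ⊔ 0ℚ) * C τ
... | ∞       = if D τ ≤ᵇ t then C τ else 0ℚ

Constrained : Task → Set
Constrained τ with T τ
... | fin p _ = D τ ≤ p
... | ∞       = ⊤

SortedByDeadline : List Task → Set
SortedByDeadline = Linked (λ a b → D a ≤ D b)

expTerm : ℚ → ℕ → ℚ
expTerm y zero    = 1ℚ
expTerm y (suc k) = expTerm y k * y * (ℤ.+ 1 // suc k)

expPartial : ℚ → ℕ → ℚ
expPartial y zero    = 1ℚ
expPartial y (suc n) = expPartial y n + expTerm y (suc n)

-- "x ≤ W(0.5) + γ".  With y = x - γ: either y ≤ 0 (≤ W(0.5) since W(0.5) > 0),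
-- or y > 0 and y ≤ W(0.5), i.e. y·e^y ≤ 1/2, i.e. y·S_n(y) ≤ 1/2 for all n
-- (e^y = sup_n S_n(y) for y ≥ 0, and w ↦ w e^w is increasing on w ≥ 0).
≤W½+ : (γ x : ℚ) → Set
≤W½+ γ x = (x - γ ≤ 0ℚ) ⊎ ((n : ℕ) → (x - γ) * expPartial (x - γ) n ≤ ½)

-- Λ(T) ≤ W(0.5) + γ  on M processors (each of the three terms of the max)
ΛBound : (γ : ℚ) (M : ℕ) .{{_ : NonZero M}} → List Task → Set
ΛBound γ M Ts =
  ((t : ℚ) (h : 0ℚ < t) →
     ≤W½+ γ (div (sumQ (map (λ τ → dbf τ t) Ts) * (ℤ.+ 1 // M)) t h))
  × ≤W½+ γ (sumQ (map U Ts) * (ℤ.+ 1 // M))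
  × All (λ τ → ≤W½+ γ (Δ τ)) Ts

-- per-processor admission tests: Test Tm τk = "τk can be added to a
-- processor currently holding Tm"

Test : Set₁
Test = List Task → Task → Set

-- (i) time-demand analysis.  For T_i = ∞, ⌈t/T_i⌉ is read as 1 for t > 0
-- (the single job interferes).
interference : ℚ → Task → ℚ
interference t τ with T τ
... | fin p h = ℤ→ℚ (ceiling (div t p h)) * C τ
... | ∞       = C τ

TDA : Test
TDA Tm τk = Σ ℚ λ t → (0ℚ < t) × (t ≤ D τk)
              × (C τk + sumQ (map (interference t) Tm) ≤ t)

longPeriod : ℚ → Task → Bool
longPeriod Dk τ with T τ
... | fin p _ = Dk ≤ᵇ p
... | ∞       = true

Hyperbolic : Test
Hyperbolic Tm τk =
  (div (C τk + sumQ (map (λ τ → if longPeriod (D τk) τ then C τ else 0ℚ) Tm))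
       (D τk) (D>0 τk) + 1ℚ)
  * prodQ (map (λ τ → if longPeriod (D τk) τ then 1ℚ else U τ + 1ℚ) Tm)
  ≤ (ℤ.+ 2 // 1)

data FailsFrom (test : Test) {M : ℕ} : Vector (List Task) M → List Task → Set where
  stuck  : ∀ {S τ rest} → (∀ m → ¬ test (S m) τ) → FailsFrom test S (τ ∷ rest)
  assign : ∀ {S τ rest} (m : Fin M) → test (S m) τ →
           FailsFrom test (updateAt S m (λ Tm → Tm ++ [ τ ])) rest →
           FailsFrom test S (τ ∷ rest)

-- The algorithm on M processors returns failure on Ts (listed in the
-- deadline-monotonic order) for some fitting strategy.
DMPFails : Test → ℕ → List Task → Set
DMPFails test zero    _         = ⊥
DMPFails test (suc M) []        = ⊥
DMPFails test (suc M) (τ ∷ Ts) =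
  FailsFrom test (updateAt {n = suc M} (λ _ → []) Fin.zero (λ _ → [ τ ])) Ts

{-# OPTIONS --safe #-}
module Submission where

-- Let a be the largest number of the form (1 + z)⁻ⁿ with a < 2y, y = n z; then y ≈ W(1/2) for
-- small z. Every processor receives n tasks of utilisation z with periods (= deadlines) a = wⁿ,
-- …, w² and w, where w = (1 + z)⁻¹, and then one task with infinite period, deadline 1 and
-- execution time c = y + a − 1. All these tasks pass both tests. The last task, with execution
-- time y and deadline 1, fails on every processor: both tests would need y + c + 1 ≤ 2a, i.e.
-- 2y ≤ a. The total utilisation is M y. For t ≥ 1 the demand per processor is at most
-- c + y t − R plus the share y/M of the last task, where R is z times the sum of the remainders
-- of t modulo the periods (y t − R ≤ y t also settles t < 1). R ≥ c is clear
-- for t < 2a, and for t ≥ 2a a Riemann sum of the fractional part gives R ≥ a(1 − a)² up to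
-- O(z t), which suffices because a² ≤ 1/2.

open import Defs
open import Algebra.Bundles using (CommutativeRing)
open import Data.Bool using (true; false; if_then_else_) renaming (T to IsTrue)
open import Data.Fin as Fin using (Fin; toℕ; fromℕ<)
import Data.Fin.Properties as Finₚ
open import Data.Integer as ℤ using (ℤ; +_; -[1+_])
import Data.Integer.DivMod as ℤDM
import Data.Integer.Properties as ℤₚ
open import Data.List using (List; []; _∷_; [_]; _++_; map; replicate)
open import Data.List.Properties using (++-assoc; ++-identityʳ)
open import Data.List.Relation.Unary.All as All using (All)
import Data.List.Relation.Unary.All.Properties as Allₚ
open import Data.List.Relation.Unary.Linked as Linked using (Linked)
open import Data.Nat as ℕ using (ℕ; zero; suc; NonZero)
import Data.Nat.Properties as ℕₚ
open import Data.Product using (_×_; _,_; proj₁; proj₂; ∃-syntax)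
open import Data.Rational
  using ( ℚ; mkℚ; 0ℚ; 1ℚ; ½; _+_; _*_; _-_; -_; 1/_; _≤_; _<_; *<*; _⊔_; _≤ᵇ_; floor; ceiling
        ; toℚᵘ; positive; nonNegative; >-nonZero)
  renaming (_/_ to _//_)
open import Data.Rational.Properties
open import Data.Rational.Unnormalised as ℚᵘ using (mkℚᵘ)
import Data.Rational.Unnormalised.Properties as ℚᵘₚ
open import Algebra.Properties.Semiring.Exp (CommutativeRing.semiring +-*-commutativeRing)
  using (_^_; ^-assocʳ)
open import Data.Sum using (_⊎_; inj₁; inj₂)
open import Data.Unit using (⊤; tt)
open import Data.Vec.Functional using (Vector; updateAt)
open import Data.Vec.Functional.Properties using (updateAt-updates; updateAt-minimal)
open import Level using (0ℓ)
open import Relation.Binary.PropositionalEquality hiding ([_])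
open import Relation.Nullary using (¬_; Dec; yes; no; contradiction)
open import Relation.Nullary.Decidable using (dec⇒maybe; True; toWitness)
open import Tactic.RingSolver using (solve; solve-∀)
open import Tactic.RingSolver.Core.AlmostCommutativeRing using (AlmostCommutativeRing; fromCommutativeRing)

-- Order arithmetic and division on the rationals

ring : AlmostCommutativeRing 0ℓ 0ℓ
ring = fromCommutativeRing +-*-commutativeRing (λ x → dec⇒maybe (0ℚ ≟ x))

infixl 6 _⊕_ _⊕₊_
infixl 7 _⊗_ _⊗₊_

_⊕_ : ∀ {p q} → 0ℚ ≤ p → 0ℚ ≤ q → 0ℚ ≤ p + q
_⊕_ = +-mono-≤

_⊗_ : ∀ {p q} → 0ℚ ≤ p → 0ℚ ≤ q → 0ℚ ≤ p * q
_⊗_ {p} {q} hp hq = subst (_≤ p * q) (*-zeroʳ p) (*-monoˡ-≤-nonNeg p {{nonNegative hp}} hq)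

_⊕₊_ : ∀ {p q} → 0ℚ ≤ p → 0ℚ < q → 0ℚ < p + q
_⊕₊_ = +-mono-≤-<

_⊗₊_ : ∀ {p q} → 0ℚ < p → 0ℚ < q → 0ℚ < p * q
_⊗₊_ {p} {q} hp hq = subst (_< p * q) (*-zeroʳ p) (*-monoʳ-<-pos p {{positive hp}} hq)

gap : ∀ {p q} → p ≤ q → 0ℚ ≤ q - p
gap {p} {q} h = subst (_≤ q - p) (+-inverseʳ p) (+-monoˡ-≤ (- p) h)

gap₊ : ∀ {p q} → p < q → 0ℚ < q - p
gap₊ {p} {q} h = subst (_< q - p) (+-inverseʳ p) (+-monoˡ-< (- p) h)

≥0 : ∀ q {_ : True (0ℚ ≤? q)} → 0ℚ ≤ q
≥0 q {h} = toWitness h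

>0 : ∀ q {_ : True (0ℚ <? q)} → 0ℚ < q
>0 q {h} = toWitness h

-- Inequalities are proved by certificates: the difference of the two sides is written as a
-- nonnegative combination of the hypotheses, and the ring solver checks this identity.
≤-from : ∀ {x y d} → 0ℚ ≤ d → y ≡ x + d → x ≤ y
≤-from {x} h e = subst₂ _≤_ (+-identityʳ x) (sym e) (+-monoʳ-≤ x h)

<-from : ∀ {x y d} → 0ℚ < d → y ≡ x + d → x < y
<-from {x} h e = subst₂ _<_ (+-identityʳ x) (sym e) (+-monoʳ-< x h)

≡⇒≤ : ∀ {p q} → p ≡ q → p ≤ q
≡⇒≤ = ≤-reflexive

≡⇒≥ : ∀ {p q} → p ≡ q → q ≤ p
≡⇒≥ e = ≤-reflexive (sym e)

cancel-*-≤ : ∀ {p q r} → 0ℚ < r → p * r ≤ q * r → p ≤ q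
cancel-*-≤ {r = r} h = *-cancelʳ-≤-pos r {{positive h}}

cancel-*-≡ : ∀ {p q r} → 0ℚ < r → p * r ≡ q * r → p ≡ q
cancel-*-≡ h e = ≤-antisym (cancel-*-≤ h (≡⇒≤ e)) (cancel-*-≤ h (≡⇒≥ e))

sq-nonNeg : ∀ x → 0ℚ ≤ x * x
sq-nonNeg x with ≤-total 0ℚ x
... | inj₁ h = h ⊗ h
... | inj₂ h = ≤-from (gap h ⊗ gap h) (solve (x ∷ []) ring)

*-mono-≤-nonNeg : ∀ {a b c d} → 0ℚ ≤ a → 0ℚ ≤ d → a ≤ b → c ≤ d → a * c ≤ b * d
*-mono-≤-nonNeg {a} {b} {c} {d} 0≤a 0≤d a≤b c≤d =
  ≤-from (gap a≤b ⊗ 0≤d ⊕ 0≤a ⊗ gap c≤d) (solve (a ∷ b ∷ c ∷ d ∷ []) ring)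

div-* : ∀ p q h → div p q h * q ≡ p
div-* p q h = begin
  p * inv * q   ≡⟨ *-assoc p inv q ⟩
  p * (inv * q) ≡⟨ cong (p *_) (*-inverseˡ q {{>-nonZero h}}) ⟩
  p * 1ℚ        ≡⟨ *-identityʳ p ⟩
  p             ∎
  where
  open ≡-Reasoning
  inv = 1/_ q {{>-nonZero h}}

div-unique : ∀ {p q x} (h : 0ℚ < q) → x * q ≡ p → div p q h ≡ x
div-unique h e = cancel-*-≡ h (trans (div-* _ _ h) (sym e))

div-≤ : ∀ {p q x} (h : 0ℚ < q) → p ≤ x * q → div p q h ≤ x
div-≤ h le = cancel-*-≤ h (≤-trans (≡⇒≤ (div-* _ _ h)) le)

-- Integers, floor and ceiling

ι : ℤ → ℚ
ι = ℤ→ℚ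

ι-≃ : ∀ i → toℚᵘ (ι i) ℚᵘ.≃ mkℚᵘ i 0
ι-≃ i = toℚᵘ-fromℚᵘ (mkℚᵘ i 0)

ι-mono-≤ : ∀ {i j} → i ℤ.≤ j → ι i ≤ ι j
ι-mono-≤ {i} {j} h = toℚᵘ-cancel-≤
  (ℚᵘₚ.≤-respʳ-≃ (ℚᵘₚ.≃-sym (ι-≃ j)) (ℚᵘₚ.≤-respˡ-≃ (ℚᵘₚ.≃-sym (ι-≃ i))
    (ℚᵘ.*≤* (ℤₚ.*-monoʳ-≤-nonNeg (+ 1) h))))

ι-cancel-< : ∀ {i j} → ι i < ι j → i ℤ.< j
ι-cancel-< {i} {j} h
  with ℚᵘ.*<* h′ ← ℚᵘₚ.<-respʳ-≃ (ι-≃ j) (ℚᵘₚ.<-respˡ-≃ (ι-≃ i) (toℚᵘ-mono-< h))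
  = ℤₚ.*-cancelʳ-<-nonNeg (+ 1) h′

ι-+ : ∀ i j → ι (i ℤ.+ j) ≡ ι i + ι j
ι-+ i j = toℚᵘ-injective (begin
  toℚᵘ (ι (i ℤ.+ j))              ≈⟨ ι-≃ (i ℤ.+ j) ⟩
  mkℚᵘ (i ℤ.+ j) 0                ≈⟨ ℚᵘ.*≡* (cong (ℤ._* + 1)
    (sym (cong₂ ℤ._+_ (ℤₚ.*-identityʳ i) (ℤₚ.*-identityʳ j)))) ⟩
  mkℚᵘ i 0 ℚᵘ.+ mkℚᵘ j 0          ≈⟨ ℚᵘₚ.+-cong (ι-≃ i) (ι-≃ j) ⟨
  toℚᵘ (ι i) ℚᵘ.+ toℚᵘ (ι j)      ≈⟨ toℚᵘ-homo-+ (ι i) (ι j) ⟨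
  toℚᵘ (ι i + ι j)                ∎)
  where open ℚᵘₚ.≃-Reasoning

ι-suc : ∀ i → ι (i ℤ.+ + 1) ≡ ι i + 1ℚ
ι-suc i = ι-+ i (+ 1)

ι-neg : ∀ i → ι (ℤ.- i) ≡ - ι i
ι-neg i = begin
  ι (ℤ.- i)                   ≡⟨ lemma (ι i) (ι (ℤ.- i)) ⟩
  (ι i + ι (ℤ.- i)) + - ι i   ≡⟨ cong (_+ - ι i) (ι-+ i (ℤ.- i)) ⟨
  ι (i ℤ.+ ℤ.- i) + - ι i     ≡⟨ cong (λ j → ι j + - ι i) (ℤₚ.+-inverseʳ i) ⟩
  0ℚ + - ι i                  ≡⟨ +-identityˡ (- ι i) ⟩
  - ι i                       ∎
  where
  open ≡-Reasoning
  lemma : ∀ x y → y ≡ (x + y) + - x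
  lemma = solve-∀ ring

ι-* : ∀ i j → ι (i ℤ.* j) ≡ ι i * ι j
ι-* i j = toℚᵘ-injective (begin
  toℚᵘ (ι (i ℤ.* j))              ≈⟨ ι-≃ (i ℤ.* j) ⟩
  mkℚᵘ i 0 ℚᵘ.* mkℚᵘ j 0          ≈⟨ ℚᵘₚ.*-cong (ι-≃ i) (ι-≃ j) ⟨
  toℚᵘ (ι i) ℚᵘ.* toℚᵘ (ι j)      ≈⟨ toℚᵘ-homo-* (ι i) (ι j) ⟨
  toℚᵘ (ι i * ι j)                ∎)
  where open ℚᵘₚ.≃-Reasoning

ι-1/ : ∀ m .{{_ : NonZero m}} → ι (+ m) * (+ 1 // m) ≡ 1ℚ
ι-1/ (suc m) = toℚᵘ-injective (begin
  toℚᵘ (ι (+ suc m) * (+ 1 // suc m))              ≈⟨ toℚᵘ-homo-* (ι (+ suc m)) (+ 1 // suc m) ⟩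
  toℚᵘ (ι (+ suc m)) ℚᵘ.* toℚᵘ (+ 1 // suc m)      ≈⟨ ℚᵘₚ.*-cong (ι-≃ (+ suc m))
    (toℚᵘ-fromℚᵘ (mkℚᵘ (+ 1) m)) ⟩
  mkℚᵘ (+ suc m) 0 ℚᵘ.* mkℚᵘ (+ 1) m               ≈⟨ ℚᵘ.*≡*
    (trans (ℤₚ.*-comm (+ suc m ℤ.* + 1) (+ 1)) (cong (ℤ._*_ (+ 1)) (ℤₚ.*-comm (+ suc m) (+ 1)))) ⟩
  mkℚᵘ (+ 1) 0                                     ∎)
  where
  open ℚᵘₚ.≃-Reasoning

floor-≤ : ∀ x → ι (floor x) ≤ x
floor-≤ x@(mkℚ n d-1 _) = toℚᵘ-cancel-≤ (ℚᵘₚ.≤-respˡ-≃ (ℚᵘₚ.≃-sym (ι-≃ (floor x)))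
  (ℚᵘ.*≤* (subst (floor x ℤ.* + suc d-1 ℤ.≤_) (sym (ℤₚ.*-identityʳ n)) (ℤDM.[n/d]*d≤n n (+ suc d-1)))))

<-floor+1 : ∀ x → x < ι (floor x) + 1ℚ
<-floor+1 x@(mkℚ n d-1 _) = subst (x <_) (ι-suc (floor x))
  (toℚᵘ-cancel-< (ℚᵘₚ.<-respʳ-≃ (ℚᵘₚ.≃-sym (ι-≃ (floor x ℤ.+ + 1)))
    (ℚᵘ.*<* (subst₂ ℤ._<_ (sym (ℤₚ.*-identityʳ n)) (cong (ℤ._* + suc d-1) eq)
      (ℤDM.n<s[n/ℕd]*d n (suc d-1))))))
  where
  eq : ℤ.suc (n ℤDM./ℕ suc d-1) ≡ floor x ℤ.+ + 1
  eq = trans (ℤₚ.+-comm (+ 1) (n ℤDM./ℕ suc d-1)) (cong (ℤ._+ + 1) (sym (ℤDM.div-pos-is-/ℕ n (suc d-1))))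

-- Follows from ⌈x⌉ = -⌊-x⌋, an unfolding that the match on `record{}` exposes.
≤-ceiling : ∀ x → x ≤ ι (ceiling x)
≤-ceiling x@record{} = subst (x ≤_) (sym (ι-neg (floor (- x))))
  (≤-from (gap (floor-≤ (- x))) (lemma x (ι (floor (- x)))))
  where
  lemma : ∀ x f → - f ≡ x + (- x - f)
  lemma = solve-∀ ring

ceiling<+1 : ∀ x → ι (ceiling x) < x + 1ℚ
ceiling<+1 x@record{} = subst (_< x + 1ℚ) (sym (ι-neg (floor (- x))))
  (<-from (gap₊ (<-floor+1 (- x))) (lemma x (ι (floor (- x)))))
  where
  lemma : ∀ x f → x + 1ℚ ≡ - f + (f + 1ℚ - (- x))
  lemma = solve-∀ ring

-- The one place where integrality enters: strict bounds on job counts are sharpened to the next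
-- integer below.
ι-≤-pred : ∀ {i j} → ι i < ι j + 1ℚ → ι i ≤ ι j
ι-≤-pred {i} {j} h = ι-mono-≤ (subst (i ℤ.≤_) (ℤₚ.pred-suc j)
  (ℤₚ.i<j⇒i≤pred[j] (ι-cancel-< {i} {ℤ.suc j} i<j+1)))
  where
  i<j+1 : ι i < ι (ℤ.suc j)
  i<j+1 = subst (ι i <_) (trans (sym (ι-suc j)) (cong ι (ℤₚ.+-comm j (+ 1)))) h

-- Runs of the partitioning algorithm

-- M copies of each task, so that every processor can end up with one copy of σ.
spread : ℕ → List Task → List Task → List Task
spread M []      ρ = ρ
spread M (x ∷ σ) ρ = replicate M x ++ spread M σ ρ

Passes : Test → List Task → List Task → Set
Passes test L []      = ⊤
Passes test L (x ∷ σ) = test L x × Passes test (L ++ [ x ]) σ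

module _ {test : Test} {M : ℕ} where

  -- The copies of `τ` go to the processors in order of index. Invariant: the processors below `k`
  -- already hold their copy, the others still hold `L`, and `j` copies remain.
  fails-block : ∀ {L τ rest} → test L τ →
    ((S : Vector (List Task) M) → (∀ m → S m ≡ L ++ [ τ ]) → FailsFrom test S rest) →
    ∀ j k (S : Vector (List Task) M) → j ℕ.+ k ≡ M →
    (∀ m → toℕ m ℕ.< k → S m ≡ L ++ [ τ ]) → (∀ m → k ℕ.≤ toℕ m → S m ≡ L) →
    FailsFrom test S (replicate j τ ++ rest)
  fails-block ok continue zero k S refl served _ =
    continue S (λ m → served m (Finₚ.toℕ<n m))
  fails-block {L} {τ} ok continue (suc j) k S eq served waiting =
    assign i (subst (λ l → test l τ) (sym (waiting i (ℕₚ.≤-reflexive (sym i≡k)))) ok)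
      (fails-block ok continue j (suc k) S′ (trans (ℕₚ.+-suc j k) eq) served′ waiting′)
    where
    k<M : k ℕ.< M
    k<M = subst (k ℕ.<_) eq (ℕ.s≤s (ℕₚ.m≤n+m k j))
    i : Fin M
    i = fromℕ< k<M
    i≡k : toℕ i ≡ k
    i≡k = Finₚ.toℕ-fromℕ< k<M
    S′ = updateAt S i (λ Tm → Tm ++ [ τ ])
    served′ : ∀ m → toℕ m ℕ.< suc k → S′ m ≡ L ++ [ τ ]
    served′ m (ℕ.s≤s m≤k) with ℕₚ.m≤n⇒m<n∨m≡n m≤k
    ... | inj₁ m<k  = trans
      (updateAt-minimal m i S λ m≡i → ℕₚ.<⇒≢ m<k (trans (cong toℕ m≡i) i≡k)) (served m m<k)
    ... | inj₂ m≡k rewrite Finₚ.toℕ-injective (trans m≡k (sym i≡k)) = trans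
      (updateAt-updates i S) (cong (_++ [ τ ]) (waiting i (ℕₚ.≤-reflexive (sym i≡k))))
    waiting′ : ∀ m → suc k ℕ.≤ toℕ m → S′ m ≡ L
    waiting′ m k<m = trans
      (updateAt-minimal m i S λ m≡i → ℕₚ.<⇒≢ k<m (sym (trans (cong toℕ m≡i) i≡k)))
      (waiting m (ℕₚ.<⇒≤ k<m))

  -- After each block all processors hold the same list, so the run is governed by a single
  -- processor, and a test that rejects the last task there rejects it everywhere.
  fails-spread : ∀ {τ} σ {L} → Passes test L σ → ¬ test (L ++ σ) τ →
    (S : Vector (List Task) M) → (∀ m → S m ≡ L) → FailsFrom test S (spread M σ [ τ ])
  fails-spread {τ} [] {L} _ ¬ok S S≡L =
    stuck (λ m → subst (λ l → ¬ test l τ) (trans (++-identityʳ L) (sym (S≡L m))) ¬ok)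
  fails-spread {τ} (x ∷ σ) {L} (ok , oks) ¬ok S S≡L =
    fails-block ok
      (fails-spread σ oks (subst (λ l → ¬ test l τ) (sym (++-assoc L [ x ] σ)) ¬ok))
      M 0 S (ℕₚ.+-identityʳ M) (λ _ ()) (λ m _ → S≡L m)

DMPFails-spread : ∀ {test τ} x σ M .{{_ : NonZero M}} → test [] x → Passes test [ x ] σ →
  ¬ test (x ∷ σ) τ → DMPFails test M (spread M (x ∷ σ) [ τ ])
DMPFails-spread {test} x σ (suc M) ok oks ¬ok =
  -- The algorithm puts the first task on processor 0 without a test, so the first block starts with
  -- one processor served and `M` of the `suc M` copies left.
  fails-block ok (fails-spread σ oks ¬ok) M 1 _ (ℕₚ.+-comm M 1) served waiting
  where
  S : Vector (List Task) (suc M)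
  S = updateAt (λ _ → []) Fin.zero (λ _ → [ x ])
  served : ∀ m → toℕ m ℕ.< 1 → S m ≡ [ x ]
  served Fin.zero _ = refl
  served (Fin.suc m) (ℕ.s≤s ())
  waiting : ∀ m → 1 ℕ.≤ toℕ m → S m ≡ []
  waiting (Fin.suc m) _ = refl

replicate-linked : ∀ {x ρ} → SortedByDeadline (x ∷ ρ) → ∀ k → SortedByDeadline (x ∷ (replicate k x ++ ρ))
replicate-linked s zero    = s
replicate-linked s (suc k) = ≤-refl Linked.∷ replicate-linked s k

spread-sorted : ∀ M .{{_ : NonZero M}} {ρ} x σ → SortedByDeadline (x ∷ (σ ++ ρ)) →
  SortedByDeadline (spread M (x ∷ σ) ρ)
spread-sorted (suc M) x []      s         = replicate-linked s M
spread-sorted (suc M) x (y ∷ σ) (x≤y Linked.∷ s) =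
  replicate-linked (x≤y Linked.∷ spread-sorted (suc M) y σ s) M

spread-All : ∀ {P : Task → Set} M {ρ} σ → All P (σ ++ ρ) → All P (spread M σ ρ)
spread-All M []      ps       = ps
spread-All {P} M {ρ} (x ∷ σ) (p All.∷ ps) = copies M
  where
  copies : ∀ k → All P (replicate k x ++ spread M σ ρ)
  copies zero    = spread-All M σ ps
  copies (suc k) = p All.∷ copies k

spread-sum : ∀ (f : Task → ℚ) M σ ρ →
  sumQ (map f (spread M σ ρ)) ≡ ι (+ M) * sumQ (map f σ) + sumQ (map f ρ)
spread-sum f M [] ρ = lemma (ι (+ M)) (sumQ (map f ρ))
  where
  lemma : ∀ m r → r ≡ m * 0ℚ + r
  lemma = solve-∀ ring
spread-sum f M (x ∷ σ) ρ = begin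
  sumQ (map f (replicate M x ++ spread M σ ρ))      ≡⟨ copies M ⟩
  ι (+ M) * f x + sumQ (map f (spread M σ ρ))       ≡⟨ cong (_+_ (ι (+ M) * f x)) (spread-sum f M σ ρ) ⟩
  ι (+ M) * f x + (ι (+ M) * sumQ (map f σ) + sumQ (map f ρ))
                                                    ≡⟨ lemma (ι (+ M)) (f x) _ _ ⟩
  ι (+ M) * (f x + sumQ (map f σ)) + sumQ (map f ρ) ∎
  where
  open ≡-Reasoning
  lemma : ∀ m a b r → m * a + (m * b + r) ≡ m * (a + b) + r
  lemma = solve-∀ ring
  lemma₀ : ∀ a r → r ≡ 0ℚ * a + r
  lemma₀ = solve-∀ ring
  lemma₁ : ∀ k a r → a + (k * a + r) ≡ (1ℚ + k) * a + r
  lemma₁ = solve-∀ ring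
  copies : ∀ k → sumQ (map f (replicate k x ++ spread M σ ρ)) ≡ ι (+ k) * f x + sumQ (map f (spread M σ ρ))
  copies zero    = lemma₀ (f x) _
  copies (suc k) = begin
    f x + sumQ (map f (replicate k x ++ spread M σ ρ))      ≡⟨ cong (_+_ (f x)) (copies k) ⟩
    f x + (ι (+ k) * f x + sumQ (map f (spread M σ ρ)))     ≡⟨ lemma₁ (ι (+ k)) (f x) _ ⟩
    (1ℚ + ι (+ k)) * f x + sumQ (map f (spread M σ ρ))      ≡⟨ cong
      (λ q → q * f x + sumQ (map f (spread M σ ρ))) (ι-+ (+ 1) (+ k)) ⟨
    ι (+ suc k) * f x + sumQ (map f (spread M σ ρ))         ∎

-- Natural numbers as rationals

fromℕ : ℕ → ℚ
fromℕ n = ι (+ n)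

fromℕ-nonNeg : ∀ n → 0ℚ ≤ fromℕ n
fromℕ-nonNeg n = ι-mono-≤ {+ 0} {+ n} (ℤ.+≤+ ℕ.z≤n)

fromℕ-suc : ∀ n → fromℕ (suc n) ≡ 1ℚ + fromℕ n
fromℕ-suc n = ι-+ (+ 1) (+ n)

fromℕ-* : ∀ m n → fromℕ (m ℕ.* n) ≡ fromℕ m * fromℕ n
fromℕ-* m n = trans (cong ι (ℤₚ.pos-* m n)) (ι-* (+ m) (+ n))

1/n>0 : ∀ n .{{_ : NonZero n}} → 0ℚ < + 1 // n
1/n>0 (suc n) = positive⁻¹ (+ 1 // suc n) {{normalize-pos 1 (suc n)}}

-- Exponential series and powers

expTerm-nonNeg : ∀ {y} → 0ℚ ≤ y → ∀ k → 0ℚ ≤ expTerm y k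
expTerm-nonNeg 0≤y zero    = ≥0 1ℚ
expTerm-nonNeg 0≤y (suc k) = expTerm-nonNeg 0≤y k ⊗ 0≤y ⊗ <⇒≤ (1/n>0 (suc k))

expTerm-mono : ∀ {x y} → 0ℚ ≤ x → x ≤ y → ∀ k → expTerm x k ≤ expTerm y k
expTerm-mono 0≤x x≤y zero    = ≤-refl
expTerm-mono 0≤x x≤y (suc k) =
  *-mono-≤-nonNeg (expTerm-nonNeg 0≤x k ⊗ 0≤x) i≥0
    (*-mono-≤-nonNeg (expTerm-nonNeg 0≤x k) (≤-trans 0≤x x≤y) (expTerm-mono 0≤x x≤y k) x≤y) ≤-refl
  where i≥0 = <⇒≤ (1/n>0 (suc k))

expPartial-nonNeg : ∀ {y} → 0ℚ ≤ y → ∀ n → 0ℚ ≤ expPartial y n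
expPartial-nonNeg 0≤y zero    = ≥0 1ℚ
expPartial-nonNeg 0≤y (suc n) = expPartial-nonNeg 0≤y n ⊕ expTerm-nonNeg 0≤y (suc n)

expPartial-mono : ∀ {x y} → 0ℚ ≤ x → x ≤ y → ∀ n → expPartial x n ≤ expPartial y n
expPartial-mono 0≤x x≤y zero    = ≤-refl
expPartial-mono 0≤x x≤y (suc n) = +-mono-≤ (expPartial-mono 0≤x x≤y n) (expTerm-mono 0≤x x≤y (suc n))

-- The mean value inequality for yᵏ⁺¹/(k+1)!, whose derivative is yᵏ/k!.
expTerm-shift : ∀ {x s} → 0ℚ ≤ x → 0ℚ ≤ s → ∀ k →
  expTerm (x + s) (suc k) ≤ expTerm x (suc k) + s * expTerm (x + s) k
expTerm-shift {x} {s} _ _ zero = ≡⇒≤ (lemma x s)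
  where
  lemma : ∀ x s → 1ℚ * (x + s) * (+ 1 // 1) ≡ 1ℚ * x * (+ 1 // 1) + s * 1ℚ
  lemma = solve-∀ ring
expTerm-shift {x} {s} 0≤x 0≤s (suc k) = step e d (expTerm (x + s) k) i K
    (expTerm-shift 0≤x 0≤s k)
    (expTerm-nonNeg (0≤x ⊕ 0≤s) (suc k)) (expTerm-nonNeg (0≤x ⊕ 0≤s) k) (<⇒≤ (1/n>0 (suc (suc k)))) Ke Ki
  where
  e = expTerm (x + s) (suc k)
  d = expTerm x (suc k)
  i = + 1 // suc (suc k)
  j = + 1 // suc k
  K = fromℕ (suc k)
  -- Since `x * e′` is at most `(x + s) * e′`, which is `K * e`, the two error terms add up to at
  -- most `(1ℚ + K) * i * s * e`, and this is `s * e`.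
  Ki : (1ℚ + K) * i ≡ 1ℚ
  Ki = trans (cong (_* i) (sym (fromℕ-suc (suc k)))) (ι-1/ (suc (suc k)))
  rearrange : ∀ K j e w → K * (e * w * j) ≡ e * w * (K * j)
  rearrange = solve-∀ ring
  Ke : K * e ≡ expTerm (x + s) k * (x + s)
  Ke = trans (rearrange K j (expTerm (x + s) k) (x + s))
    (trans (cong (expTerm (x + s) k * (x + s) *_) (ι-1/ (suc k)))
      (*-identityʳ (expTerm (x + s) k * (x + s))))
  step : ∀ e d e′ i K → e ≤ d + s * e′ → 0ℚ ≤ e → 0ℚ ≤ e′ → 0ℚ ≤ i → K * e ≡ e′ * (x + s) →
    (1ℚ + K) * i ≡ 1ℚ →
    e * (x + s) * i ≤ d * x * i + s * e
  step e d e′ i K h 0≤e 0≤e′ 0≤i Ke Ki = ≤-from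
    (0≤i ⊗ (0≤x ⊗ gap h ⊕ 0≤s ⊗ 0≤s ⊗ 0≤e′) ⊕ 0≤s ⊗ 0≤e ⊗ gap (≡⇒≤ Ki) ⊕ 0≤s ⊗ 0≤i ⊗ gap (≡⇒≥ Ke))
    (solve (x ∷ s ∷ e ∷ d ∷ e′ ∷ i ∷ K ∷ []) ring)

-- A form of 1 - s ≤ e⁻ˢ for partial sums. Summing the mean value inequality over all terms bounds
-- the increase by `s` times the partial sum of one order less, which is at most the full one.
expPartial-shift : ∀ {x s} → 0ℚ ≤ x → 0ℚ ≤ s → ∀ n →
  expPartial (x + s) n * (1ℚ - s) ≤ expPartial x n
expPartial-shift {x} {s} 0≤x 0≤s zero = ≤-from 0≤s (lemma s)
  where
  lemma : ∀ s → 1ℚ ≡ 1ℚ * (1ℚ - s) + s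
  lemma = solve-∀ ring
expPartial-shift {x} {s} 0≤x 0≤s (suc n) =
  final _ _ _ (telescope n) (expTerm-nonNeg (0≤x ⊕ 0≤s) (suc n))
  where
  telescope : ∀ n → expPartial (x + s) (suc n) ≤ expPartial x (suc n) + s * expPartial (x + s) n
  telescope zero = ≤-trans (+-monoʳ-≤ 1ℚ (expTerm-shift 0≤x 0≤s zero))
    (≡⇒≤ (sym (+-assoc 1ℚ (expTerm x 1) (s * 1ℚ))))
  telescope (suc n) = ≤-trans (+-mono-≤ (telescope n) (expTerm-shift 0≤x 0≤s (suc n)))
    (≡⇒≤ (lemma (expPartial x (suc n)) s (expPartial (x + s) n) (expTerm x (suc (suc n)))
      (expTerm (x + s) (suc n))))
    where
    lemma : ∀ a s b c d → (a + s * b) + (c + s * d) ≡ (a + c) + s * (b + d)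
    lemma = solve-∀ ring
  final : ∀ S e T → S + e ≤ T + s * S → 0ℚ ≤ e → (S + e) * (1ℚ - s) ≤ T
  final S e T h 0≤e = ≤-from (gap h ⊕ 0≤s ⊗ 0≤e) (solve (S ∷ e ∷ T ∷ s ∷ []) ring)

expPartial-0 : ∀ n → expPartial 0ℚ n ≡ 1ℚ
expPartial-0 zero    = refl
expPartial-0 (suc n) = trans (cong₂ _+_ (expPartial-0 n) (expTerm-0 n)) (+-identityʳ 1ℚ)
  where
  expTerm-0 : ∀ k → expTerm 0ℚ (suc k) ≡ 0ℚ
  expTerm-0 k = lemma (expTerm 0ℚ k) (+ 1 // suc k)
    where
    lemma : ∀ e i → e * 0ℚ * i ≡ 0ℚ
    lemma = solve-∀ ring

^-nonNeg : ∀ {w} → 0ℚ ≤ w → ∀ k → 0ℚ ≤ w ^ k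
^-nonNeg 0≤w zero    = ≥0 1ℚ
^-nonNeg 0≤w (suc k) = 0≤w ⊗ ^-nonNeg 0≤w k

^-pos : ∀ {w} → 0ℚ < w → ∀ k → 0ℚ < w ^ k
^-pos 0<w zero    = >0 1ℚ
^-pos 0<w (suc k) = 0<w ⊗₊ ^-pos 0<w k

^-mono : ∀ {v w} → 0ℚ ≤ v → v ≤ w → ∀ k → v ^ k ≤ w ^ k
^-mono 0≤v v≤w zero    = ≤-refl
^-mono 0≤v v≤w (suc k) = *-mono-≤-nonNeg 0≤v (^-nonNeg (≤-trans 0≤v v≤w) k) v≤w (^-mono 0≤v v≤w k)

^-antitone : ∀ {w} → 0ℚ ≤ w → w ≤ 1ℚ → ∀ {j k} → j ℕ.≤ k → w ^ k ≤ w ^ j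
^-antitone {w} 0≤w w≤1 {zero} {zero} _ = ≤-refl
^-antitone {w} 0≤w w≤1 {zero} {suc k} _ = ≤-trans
  (*-mono-≤-nonNeg 0≤w (≥0 1ℚ) w≤1 (^-antitone 0≤w w≤1 {zero} {k} ℕ.z≤n)) (≡⇒≤ (*-identityʳ 1ℚ))
^-antitone {w} 0≤w w≤1 (ℕ.s≤s j≤k) = *-monoˡ-≤-nonNeg w {{nonNegative 0≤w}} (^-antitone 0≤w w≤1 j≤k)

-- eˣ ≤ (1 − s)⁻ᵏ for x = k s.
expPartial-*-^ : ∀ {s} → 0ℚ ≤ s → s ≤ 1ℚ → ∀ n k → expPartial (fromℕ k * s) n * (1ℚ - s) ^ k ≤ 1ℚ
expPartial-*-^ {s} 0≤s s≤1 n zero = ≡⇒≤ (trans (*-identityʳ _)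
  (trans (cong (λ x → expPartial x n) (*-zeroˡ s)) (expPartial-0 n)))
expPartial-*-^ {s} 0≤s s≤1 n (suc k) = ≤-trans
  (≤-from (gap (expPartial-shift (fromℕ-nonNeg k ⊗ 0≤s) 0≤s n) ⊗ ^-nonNeg (gap s≤1) k)
    (trans (lemma (expPartial (fromℕ k * s) n) (expPartial (fromℕ k * s + s) n) (1ℚ - s) ((1ℚ - s) ^ k))
      (cong (λ x → expPartial x n * ((1ℚ - s) * (1ℚ - s) ^ k)
        + (expPartial (fromℕ k * s) n - expPartial (fromℕ k * s + s) n * (1ℚ - s)) * (1ℚ - s) ^ k) arg)))
  (expPartial-*-^ 0≤s s≤1 n k)
  where
  lemma : ∀ S S′ u v → S * v ≡ S′ * (u * v) + (S - S′ * u) * v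
  lemma = solve-∀ ring
  lemma′ : ∀ k s → k * s + s ≡ (1ℚ + k) * s
  lemma′ = solve-∀ ring
  arg : fromℕ k * s + s ≡ fromℕ (suc k) * s
  arg = trans (lemma′ (fromℕ k) s) (cong (_* s) (sym (fromℕ-suc k)))

-- The hypothesis on `y` certifies y ≤ W(1/2). It passes down to `x - γ` because u times a partial
-- sum of eᵘ increases with u ≥ 0.
≤W½+-intro : ∀ {γ x y} → 0ℚ ≤ y → (∀ n → y * expPartial y n ≤ ½) → x - γ ≤ y → ≤W½+ γ x
≤W½+-intro {γ} {x} 0≤y y≤W x-γ≤y with ≤-total (x - γ) 0ℚ
... | inj₁ h = inj₁ h
... | inj₂ h = inj₂ λ n → ≤-trans
  (*-mono-≤-nonNeg h (expPartial-nonNeg 0≤y n) x-γ≤y (expPartial-mono h x-γ≤y n)) (y≤W n)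

-- Choice of the scale z and the number n of short tasks

-- A discrete intermediate value argument, searching downwards from the upper end.
crossing : ∀ {P : ℕ → Set} → (∀ n → Dec (P n)) → ∀ lo k → ¬ P lo → P (k ℕ.+ lo) →
  ∃[ n ] (lo ℕ.≤ n × n ℕ.< k ℕ.+ lo × ¬ P n × P (suc n))
crossing P? lo zero    ¬p p = contradiction p ¬p
crossing P? lo (suc k) ¬p p with P? (k ℕ.+ lo)
... | no ¬q = k ℕ.+ lo , ℕₚ.m≤n+m lo k , ℕₚ.≤-refl , ¬q , p
... | yes q with n , lo≤n , n<hi , rest ← crossing P? lo k ¬p q =
  n , lo≤n , ℕₚ.<-trans n<hi ℕₚ.≤-refl , rest

module _ {z w : ℚ} (0≤z : 0ℚ ≤ z) (0≤w : 0ℚ ≤ w) (w-eq : w + z * w ≡ 1ℚ) where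

  -- Bernoulli's inequality (1 + z)ᵏ ≥ 1 + k z, written for the inverse `w` of 1 + z.
  ^-*-bernoulli : ∀ k → w ^ k * (1ℚ + fromℕ k * z) ≤ 1ℚ
  ^-*-bernoulli zero = ≡⇒≤ (trans (*-identityˡ _) (trans (cong (_+_ 1ℚ) (*-zeroˡ z)) (+-identityʳ 1ℚ)))
  ^-*-bernoulli (suc k) = ≤-trans (≡⇒≤ (cong (λ K → w * w ^ k * (1ℚ + K * z)) (fromℕ-suc k)))
    (step (w ^ k) (fromℕ k) (^-*-bernoulli k) (^-antitone 0≤w w≤1 {0} {k} ℕ.z≤n))
    where
    w≤1 : w ≤ 1ℚ
    w≤1 = ≤-from (0≤z ⊗ 0≤w) (sym w-eq)
    step : ∀ W K → W * (1ℚ + K * z) ≤ 1ℚ → W ≤ 1ℚ → w * W * (1ℚ + (1ℚ + K) * z) ≤ 1ℚ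
    step W K h h′ = ≤-from (0≤w ⊗ gap h ⊕ 0≤z ⊗ 0≤w ⊗ gap h′ ⊕ gap (≡⇒≤ w-eq))
      (solve (W ∷ K ∷ w ∷ z ∷ []) ring)

-- Each further factor `w` lowers the power by `z * w ^ suc k`, hence by at most `z`.
1-kz≤^ : ∀ {z w} (0≤z : 0ℚ ≤ z) (0≤w : 0ℚ ≤ w) (w-eq : w + z * w ≡ 1ℚ) → ∀ k → 1ℚ - fromℕ k * z ≤ w ^ k
1-kz≤^ {z} 0≤z 0≤w w-eq zero = ≡⇒≤ (lemma z)
  where
  lemma : ∀ z → 1ℚ - 0ℚ * z ≡ 1ℚ
  lemma = solve-∀ ring
1-kz≤^ {z} {w} 0≤z 0≤w w-eq (suc k) = ≤-trans (≡⇒≤ (cong (λ K → 1ℚ - K * z) (fromℕ-suc k)))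
  (step (w ^ k) (fromℕ k) (1-kz≤^ 0≤z 0≤w w-eq k) (^-nonNeg 0≤w k) (^-antitone 0≤w w≤1 {0} {suc k} ℕ.z≤n))
  where
  w≤1 : w ≤ 1ℚ
  w≤1 = ≤-from (0≤z ⊗ 0≤w) (sym w-eq)
  step : ∀ W K → 1ℚ - K * z ≤ W → 0ℚ ≤ W → w * W ≤ 1ℚ → 1ℚ - (1ℚ + K) * z ≤ w * W
  step W K h 0≤W h′ = ≤-from (gap h ⊕ 0≤z ⊗ gap h′ ⊕ 0≤W ⊗ gap (≡⇒≥ w-eq)) (solve (W ∷ K ∷ w ∷ z ∷ []) ring)

-- Twice y = n z exceeds a = w ^ n for the first time at n = suc m, so that y ≈ W(1/2).
record Scale (δ : ℚ) : Set where
  field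
    z w : ℚ
    m   : ℕ
    z>0 : 0ℚ < z
    w>0 : 0ℚ < w
    w-eq : w + z * w ≡ 1ℚ
    z≤δ : (+ 10 // 1) * z ≤ δ
  n = suc m
  y = fromℕ n * z
  a = w ^ n
  field
    below : fromℕ m * z * (+ 2 // 1) ≤ w ^ m
    above : a < y * (+ 2 // 1)
    y≤ : y ≤ + 36 // 100
    a≥ : + 5 // 8 ≤ a
    a²≤½ : a * a ≤ ½

-- With z = 1/(100 p) the power `w ^ p` lies between 99/100 and 100/101 whatever `p` is. The
-- crossing is therefore located between the exponents 35 p and 36 p by numerical checks that do not
-- involve `p`.
scale : ∀ p .{{_ : NonZero p}} → Scale (+ 1 // p)
scale p = record
  { z = z ; w = w ; m = m ; z>0 = z>0 ; w>0 = w>0 ; w-eq = w-eq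
  ; z≤δ = ≤-from (≥0 (+ 9 // 10) ⊗ <⇒≤ (1/n>0 p)) (lemma₀ (+ 1 // p))
  ; below = ≮⇒≥ ¬Pm
  ; above = Psm
  ; y≤ = y≤
  ; a≥ = a≥
  ; a²≤½ = a²≤½
  }
  where
  z = (+ 1 // p) * (+ 1 // 100)
  z>0 : 0ℚ < z
  z>0 = 1/n>0 p ⊗₊ >0 (+ 1 // 100)
  0≤z = <⇒≤ z>0
  lemma₀ : ∀ d → d ≡ (+ 10 // 1) * (d * (+ 1 // 100)) + (+ 9 // 10) * d
  lemma₀ = solve-∀ ring
  1+z>0 : 0ℚ < 1ℚ + z
  1+z>0 = ≥0 1ℚ ⊕₊ z>0
  w = div 1ℚ (1ℚ + z) 1+z>0
  lemma₁ : ∀ w z → w + z * w ≡ w * (1ℚ + z)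
  lemma₁ = solve-∀ ring
  w-eq : w + z * w ≡ 1ℚ
  w-eq = trans (lemma₁ w z) (div-* 1ℚ (1ℚ + z) 1+z>0)
  w>0 : 0ℚ < w
  w>0 = *-cancelʳ-<-nonNeg (1ℚ + z) {{nonNegative (<⇒≤ 1+z>0)}}
    (subst₂ _<_ (sym (*-zeroˡ (1ℚ + z))) (sym (div-* 1ℚ (1ℚ + z) 1+z>0)) (>0 1ℚ))
  0≤w = <⇒≤ w>0
  w≤1 : w ≤ 1ℚ
  w≤1 = ≤-from (0≤z ⊗ 0≤w) (sym w-eq)
  pz : ∀ k → fromℕ (p ℕ.* k) * z ≡ fromℕ k * (+ 1 // 100)
  pz k = trans (cong (_* z) (fromℕ-* p k)) (trans (lemma₂ (fromℕ p) (fromℕ k) (+ 1 // p))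
    (trans (cong (_* (fromℕ k * (+ 1 // 100))) (ι-1/ p)) (*-identityˡ _)))
    where
    lemma₂ : ∀ p k d → p * k * (d * (+ 1 // 100)) ≡ p * d * (k * (+ 1 // 100))
    lemma₂ = solve-∀ ring
  pz₁ : fromℕ p * z ≡ + 1 // 100
  pz₁ = trans (cong (λ q → fromℕ q * z) (sym (ℕₚ.*-identityʳ p))) (pz 1)
  A = w ^ p
  -- Bounds for A, which is close to exp (− 1/100).
  lo hi : ℚ
  lo = + 99 // 100
  hi = + 100 // 101
  lo≤A : lo ≤ A
  lo≤A = ≤-trans (≡⇒≤ (cong (λ q → 1ℚ - q) (sym pz₁))) (1-kz≤^ 0≤z 0≤w w-eq p)
  A≤hi : A ≤ hi
  A≤hi = cancel-*-≤ (>0 (+ 101 // 100))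
    (≤-trans (≡⇒≤ (cong (λ q → A * (1ℚ + q)) (sym pz₁))) (^-*-bernoulli 0≤z 0≤w w-eq p))
  lo≤ : ∀ k → lo ^ k ≤ w ^ (p ℕ.* k)
  lo≤ k = ≤-trans (^-mono (≥0 lo) lo≤A k) (≡⇒≤ (^-assocʳ w p k))
  ≤hi : ∀ k → w ^ (p ℕ.* k) ≤ hi ^ k
  ≤hi k = ≤-trans (≡⇒≥ (^-assocʳ w p k)) (^-mono (^-nonNeg 0≤w p) A≤hi k)

  P : ℕ → Set
  P k = w ^ k < fromℕ k * z * (+ 2 // 1)
  ¬P35 : ¬ P (p ℕ.* 35)
  ¬P35 h = <-irrefl refl (<-≤-trans h (≤-trans (≡⇒≤ (cong (_* (+ 2 // 1)) (pz 35)))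
    (≤-trans (toWitness {a? = fromℕ 35 * (+ 1 // 100) * (+ 2 // 1) ≤? lo ^ 35} _) (lo≤ 35))))
  36= : p ℕ.* 36 ≡ p ℕ.+ p ℕ.* 35
  36= = ℕₚ.*-suc p 35
  P36 : P (p ℕ.+ p ℕ.* 35)
  P36 = subst P 36= (≤-<-trans (≤hi 36)
    (<-≤-trans (toWitness {a? = hi ^ 36 <? fromℕ 36 * (+ 1 // 100) * (+ 2 // 1)} _)
      (≡⇒≤ (cong (_* (+ 2 // 1)) (sym (pz 36))))))
  -- 0.35 < W(1/2) < 0.36, hence the search range.
  found = crossing (λ k → w ^ k <? fromℕ k * z * (+ 2 // 1)) (p ℕ.* 35) p ¬P35 P36
  m = proj₁ found
  35≤m : p ℕ.* 35 ℕ.≤ m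
  35≤m = proj₁ (proj₂ found)
  m<36 : m ℕ.< p ℕ.* 36
  m<36 = subst (m ℕ.<_) (sym 36=) (proj₁ (proj₂ (proj₂ found)))
  ¬Pm = proj₁ (proj₂ (proj₂ (proj₂ found)))
  Psm = proj₂ (proj₂ (proj₂ (proj₂ found)))
  y≤ : fromℕ (suc m) * z ≤ + 36 // 100
  y≤ = ≤-trans (*-monoʳ-≤-nonNeg z {{nonNegative 0≤z}} (ι-mono-≤ {+ suc m} {+ (p ℕ.* 36)} (ℤ.+≤+ m<36)))
    (≡⇒≤ (pz 36))
  a≥ : + 5 // 8 ≤ w ^ suc m
  a≥ = ≤-trans (toWitness {a? = + 5 // 8 ≤? lo ^ 36} _) (≤-trans (lo≤ 36) (^-antitone 0≤w w≤1 m<36))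
  a≤ : w ^ suc m ≤ hi ^ 35
  a≤ = ≤-trans (^-antitone 0≤w w≤1 (ℕₚ.m≤n⇒m≤1+n 35≤m)) (≤hi 35)
  0≤a = ^-nonNeg 0≤w (suc m)
  a²≤½ : w ^ suc m * w ^ suc m ≤ ½
  a²≤½ = ≤-trans (*-mono-≤-nonNeg 0≤a (^-nonNeg (≥0 hi) 35) a≤ a≤)
    (toWitness {a? = hi ^ 35 * hi ^ 35 ≤? ½} _)

-- Integral of the fractional part

floorℚ : ℚ → ℚ
floorℚ x = ι (floor x)

floor-unique : ∀ {i x} → ι i ≤ x → x < ι i + 1ℚ → ι i ≡ floorℚ x
floor-unique {i} {x} i≤x x<i+1 = ≤-antisym
  (ι-≤-pred {i} {floor x} (≤-<-trans i≤x (<-floor+1 x)))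
  (ι-≤-pred {floor x} {i} (≤-<-trans (floor-≤ x) x<i+1))

floorℚ-nonNeg : ∀ {x} → 0ℚ ≤ x → 0ℚ ≤ floorℚ x
floorℚ-nonNeg {x} 0≤x = ι-≤-pred {+ 0} {floor x} (≤-<-trans 0≤x (<-floor+1 x))

floorℚ-step : ∀ {x y} → x ≤ y → floorℚ x ≡ floorℚ y ⊎ floorℚ x + 1ℚ ≤ floorℚ y
floorℚ-step {x} {y} x≤y with y <? floorℚ x + 1ℚ
... | yes y<  = inj₁ (floor-unique {floor x} (≤-trans (floor-≤ x) x≤y) y<)
... | no  y≮ = inj₂ (≤-trans (≡⇒≥ (ι-suc (floor x)))
  (ι-≤-pred {floor x ℤ.+ + 1} {floor y} (≤-<-trans (≤-trans (≡⇒≤ (ι-suc (floor x))) (≮⇒≥ y≮))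
    (<-floor+1 y))))

-- Twice the integral of the fractional part over [0, x].
B² : ℚ → ℚ
B² x = floorℚ x + (x - floorℚ x) * (x - floorℚ x)

-- A left Riemann sum of the fractional part: jumps go down, so they only help.
B²-increment : ∀ x {h} → 0ℚ ≤ h → B² (x + h) ≤ B² x + (h * (x - floorℚ x) + h * h) * (+ 2 // 1)
B²-increment x {h} 0≤h with floorℚ-step {x} {x + h} (≤-from 0≤h refl)
... | inj₁ eq = subst (λ F → F + (x + h - F) * (x + h - F)
    ≤ B² x + (h * (x - floorℚ x) + h * h) * (+ 2 // 1)) eq
  (same (floorℚ x))
  where
  same : ∀ F → F + (x + h - F) * (x + h - F) ≤ F + (x - F) * (x - F) + (h * (x - F) + h * h) * (+ 2 // 1)
  same F = ≤-from (sq-nonNeg h) (solve (F ∷ x ∷ h ∷ []) ring)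
... | inj₂ crossed = jump (floorℚ x) (floorℚ (x + h)) crossed (floor-≤ x) (floor-≤ (x + h))
    (<⇒≤ (<-floor+1 x)) (<⇒≤ (<-floor+1 (x + h)))
  where
  jump : ∀ F G → F + 1ℚ ≤ G → F ≤ x → G ≤ x + h → x ≤ F + 1ℚ → x + h ≤ G + 1ℚ →
    G + (x + h - G) * (x + h - G) ≤ F + (x - F) * (x - F) + (h * (x - F) + h * h) * (+ 2 // 1)
  jump F G F+1≤G F≤x G≤x+h x≤F+1 x+h≤G+1 = ≤-from
    ( sq-nonNeg (1ℚ - (x - F))
    ⊕ (gap F+1≤G ⊕ gap G≤x+h)
    ⊕ 0≤h ⊗ (gap F+1≤G ⊕ gap G≤x+h) ⊗ ≥0 (+ 2 // 1)
    ⊕ gap G≤x+h ⊗ gap x+h≤G+1)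
    (solve (F ∷ G ∷ x ∷ h ∷ []) ring)

-- For fractional parts f and g the excess is 2 f g when f + g < 1, and 2 (1 - f)(1 - g) otherwise.
B²-superadditive : ∀ x y → B² x + B² y ≤ B² (x + y)
B²-superadditive x y with x + y <? floorℚ x + floorℚ y + 1ℚ
... | yes x+y< = subst (λ F → B² x + B² y ≤ F + (x + y - F) * (x + y - F)) eq
    (bound (floorℚ x) (floorℚ y) (floor-≤ x) (floor-≤ y))
  where
  eq : floorℚ x + floorℚ y ≡ floorℚ (x + y)
  eq = trans (sym (ι-+ (floor x) (floor y))) (floor-unique {floor x ℤ.+ floor y}
    (≤-trans (≡⇒≤ (ι-+ (floor x) (floor y))) (+-mono-≤ (floor-≤ x) (floor-≤ y)))
    (<-≤-trans x+y< (≡⇒≥ (cong (_+ 1ℚ) (ι-+ (floor x) (floor y))))))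
  bound : ∀ F G → F ≤ x → G ≤ y → F + (x - F) * (x - F) + (G + (y - G) * (y - G))
    ≤ F + G + (x + y - (F + G)) * (x + y - (F + G))
  bound F G hF hG = ≤-from (≥0 (+ 2 // 1) ⊗ gap hF ⊗ gap hG) (solve (F ∷ G ∷ x ∷ y ∷ []) ring)
... | no x+y≮ = subst (λ F → B² x + B² y ≤ F + (x + y - F) * (x + y - F)) eq
    (bound (floorℚ x) (floorℚ y) (<⇒≤ (<-floor+1 x)) (<⇒≤ (<-floor+1 y)))
  where
  i = floor x ℤ.+ floor y ℤ.+ + 1
  ιi : ι i ≡ floorℚ x + floorℚ y + 1ℚ
  ιi = trans (ι-suc (floor x ℤ.+ floor y)) (cong (_+ 1ℚ) (ι-+ (floor x) (floor y)))
  lemma : ∀ F G → F + 1ℚ + (G + 1ℚ) ≡ F + G + 1ℚ + 1ℚ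
  lemma = solve-∀ ring
  eq : floorℚ x + floorℚ y + 1ℚ ≡ floorℚ (x + y)
  eq = trans (sym ιi) (floor-unique {i} (≤-trans (≡⇒≤ ιi) (≮⇒≥ x+y≮))
    (<-≤-trans (+-mono-< (<-floor+1 x) (<-floor+1 y))
      (≡⇒≤ (trans (lemma (floorℚ x) (floorℚ y)) (cong (_+ 1ℚ) (sym ιi))))))
  bound : ∀ F G → x ≤ F + 1ℚ → y ≤ G + 1ℚ → F + (x - F) * (x - F) + (G + (y - G) * (y - G))
    ≤ F + G + 1ℚ + (x + y - (F + G + 1ℚ)) * (x + y - (F + G + 1ℚ))
  bound F G hF hG = ≤-from (≥0 (+ 2 // 1) ⊗ gap hF ⊗ gap hG) (solve (F ∷ G ∷ x ∷ y ∷ []) ring)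

-- Below 1 the function is x², and x ≥ β suffices. From 1 on, the floor dominates, and the
-- fractional part f is handled by (f - 1/2)² ≥ 0; the 1/4 left over there is why β may be at most
-- 3/4.
B²-linear : ∀ {β x} → 0ℚ ≤ β → β ≤ + 3 // 4 → β ≤ x → β * x ≤ B² x
B²-linear {β} {x} 0≤β β≤¾ β≤x with floorℚ-step {0ℚ} {x} (≤-trans 0≤β β≤x)
... | inj₁ 0≡F = subst (λ F → β * x ≤ F + (x - F) * (x - F)) 0≡F
  (≤-from (gap β≤x ⊗ ≤-trans 0≤β β≤x) (lemma β x))
  where
  lemma : ∀ β x → 0ℚ + (x - 0ℚ) * (x - 0ℚ) ≡ β * x + (x - β) * x
  lemma = solve-∀ ring
... | inj₂ 1≤F = bound (floorℚ x) 1≤F (floor-≤ x)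
  where
  bound : ∀ F → 0ℚ + 1ℚ ≤ F → F ≤ x → β * x ≤ F + (x - F) * (x - F)
  bound F 1≤F F≤x = ≤-from
    ( sq-nonNeg (x - F - ½) ⊕ gap β≤1 ⊗ gap F≤x ⊕ gap β≤1 ⊗ gap 1≤F ⊕ gap β≤¾)
    (solve (F ∷ x ∷ β ∷ []) ring)
    where
    β≤1 : β ≤ 1ℚ
    β≤1 = ≤-trans β≤¾ (≤-from (≥0 (+ 1 // 4)) refl)

-- Sums and products over task lists, and job counts

≰⇒≤ᵇ-false : ∀ {p q} → ¬ p ≤ q → (p ≤ᵇ q) ≡ false
≰⇒≤ᵇ-false {p} {q} p≰q with p ≤ᵇ q in eq
... | false = refl
... | true  = contradiction (≤ᵇ⇒≤ (subst IsTrue (sym eq) tt)) p≰q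

sumQ-++ : ∀ (f : Task → ℚ) xs ys → sumQ (map f (xs ++ ys)) ≡ sumQ (map f xs) + sumQ (map f ys)
sumQ-++ f []       ys = sym (+-identityˡ _)
sumQ-++ f (x ∷ xs) ys = trans (cong (_+_ (f x)) (sumQ-++ f xs ys)) (sym (+-assoc (f x) _ _))

prodQ-++ : ∀ (f : Task → ℚ) xs ys → prodQ (map f (xs ++ ys)) ≡ prodQ (map f xs) * prodQ (map f ys)
prodQ-++ f []       ys = sym (*-identityˡ _)
prodQ-++ f (x ∷ xs) ys = trans (cong (_*_ (f x)) (prodQ-++ f xs ys)) (sym (*-assoc (f x) _ _))

sumQ-snoc : ∀ (f : Task → ℚ) xs x → sumQ (map f (xs ++ [ x ])) ≡ sumQ (map f xs) + f x
sumQ-snoc f xs x = trans (sumQ-++ f xs [ x ]) (cong (_+_ (sumQ (map f xs))) (+-identityʳ (f x)))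

prodQ-snoc : ∀ (f : Task → ℚ) xs x → prodQ (map f (xs ++ [ x ])) ≡ prodQ (map f xs) * f x
prodQ-snoc f xs x = trans (prodQ-++ f xs [ x ]) (cong (_*_ (prodQ (map f xs))) (*-identityʳ (f x)))

-- When the deadline equals the period P, the job count ⌊(t - P)/P⌋ + 1 of `dbf` is ⌊t/P⌋.
floor-release : ∀ {t P x} (h : 0ℚ < P) → 0ℚ ≤ x → x * P ≡ t →
  ι (floor (div (t - P) P h) ℤ.+ + 1) ⊔ 0ℚ ≡ floorℚ x
floor-release {t} {P} {x} h 0≤x xP≡t = trans (p≥q⇒p⊔q≡p (subst (0ℚ ≤_) (sym eq) (floorℚ-nonNeg 0≤x))) eq
  where
  k = floor (div (t - P) P h) ℤ.+ + 1
  f = floorℚ (div (t - P) P h)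
  lemma : ∀ x P → (x - 1ℚ) * P ≡ x * P - P
  lemma = solve-∀ ring
  x-1 : div (t - P) P h ≡ x - 1ℚ
  x-1 = div-unique h (trans (lemma x P) (cong (λ s → s - P) xP≡t))
  lower : ∀ f → f ≤ x - 1ℚ → f + 1ℚ ≤ x
  lower f h = ≤-from (gap h) (solve (f ∷ x ∷ []) ring)
  upper : ∀ f → x - 1ℚ < f → x < f + 1ℚ
  upper f h = <-from (gap₊ h) (solve (f ∷ x ∷ []) ring)
  eq : ι k ≡ floorℚ x
  eq = floor-unique {k} {x}
    (≤-trans (≡⇒≤ (ι-suc (floor (div (t - P) P h)))) (lower f (≤-trans (floor-≤ _) (≡⇒≤ x-1))))
    (upper (ι k) (≤-<-trans (≡⇒≥ x-1) (<-≤-trans (<-floor+1 _) (≡⇒≥ (ι-suc (floor (div (t - P) P h)))))))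

-- The short tasks and their demand

module Construction {δ : ℚ} (s : Scale δ) where
  open Scale s

  0≤z = <⇒≤ z>0
  0≤w = <⇒≤ w>0
  a>0 = ^-pos w>0 n
  0≤a = <⇒≤ a>0

  w≤1 : w ≤ 1ℚ
  w≤1 = ≤-from (0≤z ⊗ 0≤w) (sym w-eq)

  w^≤1 : ∀ e → w ^ e ≤ 1ℚ
  w^≤1 e = ^-antitone 0≤w w≤1 {0} {e} ℕ.z≤n

  w^-suc : ∀ e → w ^ suc e + z * w ^ suc e ≡ w ^ e
  w^-suc e = trans (lemma w z (w ^ e)) (trans (cong (_* w ^ e) w-eq) (*-identityˡ (w ^ e)))
    where
    lemma : ∀ w z W → w * W + z * (w * W) ≡ (w + z * w) * W
    lemma = solve-∀ ring

  short : ℕ → Task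
  short e = task (z * w ^ e) (fin (w ^ e) (^-pos w>0 e)) (w ^ e) (z>0 ⊗₊ ^-pos w>0 e) (^-pos w>0 e)

  shorts : ℕ → List Task
  shorts zero    = []
  shorts (suc e) = short (suc e) ∷ shorts e

  -- X t e = t / w ^ e.
  X : ℚ → ℕ → ℚ
  X t zero    = t
  X t (suc e) = X t e + z * X t e

  X-nonNeg : ∀ {t} → 0ℚ ≤ t → ∀ e → 0ℚ ≤ X t e
  X-nonNeg 0≤t zero    = 0≤t
  X-nonNeg 0≤t (suc e) = X-nonNeg 0≤t e ⊕ 0≤z ⊗ X-nonNeg 0≤t e

  X-* : ∀ t e → X t e * w ^ e ≡ t
  X-* t zero    = *-identityʳ t
  X-* t (suc e) = trans (lemma (X t e) z w (w ^ e))
    (trans (cong (_* (X t e * w ^ e)) w-eq) (trans (*-identityˡ _) (X-* t e)))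
    where
    lemma : ∀ x z w W → (x + z * x) * (w * W) ≡ (w + z * w) * (x * W)
    lemma = solve-∀ ring

  dbf-short : ∀ {t} → 0ℚ ≤ t → ∀ e → dbf (short e) t ≡ floorℚ (X t e) * (z * w ^ e)
  dbf-short {t} 0≤t e = cong (_* (z * w ^ e)) (floor-release (^-pos w>0 e) (X-nonNeg 0≤t e) (X-* t e))

  G : ℚ → ℕ → ℚ
  G t e = sumQ (map (λ τ → dbf τ t) (shorts e))

  G-≤ : ∀ {t} → 0ℚ ≤ t → ∀ e → G t e ≤ fromℕ e * (z * t)
  G-≤ {t} 0≤t zero = ≡⇒≥ (*-zeroˡ (z * t))
  G-≤ {t} 0≤t (suc e) = ≤-trans (+-mono-≤ first (G-≤ 0≤t e))
    (≡⇒≤ (trans (lemma₁ (z * t) (fromℕ e)) (cong (_* (z * t)) (sym (fromℕ-suc e)))))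
    where
    W = w ^ suc e
    lemma₁ : ∀ a k → a + k * a ≡ (1ℚ + k) * a
    lemma₁ = solve-∀ ring
    lemma₂ : ∀ x z W → x * (z * W) ≡ z * (x * W)
    lemma₂ = solve-∀ ring
    first : dbf (short (suc e)) t ≤ z * t
    first = ≤-trans (≡⇒≤ (dbf-short 0≤t (suc e)))
      (≤-trans (*-monoʳ-≤-nonNeg (z * W) {{nonNegative (0≤z ⊗ ^-nonNeg 0≤w (suc e))}}
        (floor-≤ (X t (suc e))))
        (≡⇒≤ (trans (lemma₂ (X t (suc e)) z W) (cong (_*_ z) (X-* t (suc e))))))

  -- Every period is at least `a`, so before 2a each task has at most one job due. The execution
  -- times telescope, since `z * w ^ suc e` is the difference of two consecutive powers.
  G-early : ∀ {t} → 0ℚ ≤ t → t < a * (+ 2 // 1) → ∀ e → e ℕ.≤ n → G t e ≤ 1ℚ - w ^ e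
  G-early 0≤t t<2a zero e≤n = ≤-refl
  G-early {t} 0≤t t<2a (suc e) e<n = ≤-trans (+-mono-≤ first (G-early 0≤t t<2a e (ℕₚ.<⇒≤ e<n)))
    (step z (w ^ e) W (w^-suc e))
    where
    W = w ^ suc e
    x = X t (suc e)
    step : ∀ z V W → W + z * W ≡ V → 1ℚ * (z * W) + (1ℚ - V) ≤ 1ℚ - W
    step z V W eq = ≤-from (gap (≡⇒≤ eq)) (solve (V ∷ W ∷ z ∷ []) ring)
    x<2 : x < 1ℚ + 1ℚ
    x<2 = *-cancelʳ-<-nonNeg W {{nonNegative (^-nonNeg 0≤w (suc e))}}
      (≤-<-trans (≡⇒≤ (X-* t (suc e))) (<-≤-trans t<2a (lemma a W (^-antitone 0≤w w≤1 e<n))))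
      where
      lemma : ∀ a W → a ≤ W → a * (+ 2 // 1) ≤ (1ℚ + 1ℚ) * W
      lemma a W h = ≤-from (≥0 (+ 2 // 1) ⊗ gap h) (solve (a ∷ W ∷ []) ring)
    first : dbf (short (suc e)) t ≤ 1ℚ * (z * W)
    first = ≤-trans (≡⇒≤ (dbf-short 0≤t (suc e)))
      (*-monoʳ-≤-nonNeg (z * W) {{nonNegative (0≤z ⊗ ^-nonNeg 0≤w (suc e))}}
        (ι-≤-pred {floor x} {+ 1} (≤-<-trans (floor-≤ x) x<2)))

  -- The points x = t / wᵉ form a grid with steps `z * x`. A task with period W falls short of its
  -- share `z * t` by z W (x - ⌊x⌋); multiplied by t = x W this is W² times a term of the Riemann
  -- sum, and W ≥ a. The summands `z * z * t` absorb the discretisation error.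
  G-riemann : ∀ {t} → 0ℚ ≤ t → ∀ e → e ℕ.≤ n →
    a * a * (B² (X t (suc e)) - B² (X t 1))
      ≤ (fromℕ e * (z * t) - G t e + fromℕ e * (z * z * t)) * (t * (+ 2 // 1))
  G-riemann {t} 0≤t zero _ = ≡⇒≤ (lemma a (B² (X t 1)) (z * t) (z * z * t) (t * (+ 2 // 1)))
    where
    lemma : ∀ a b x y t → a * a * (b - b) ≡ (0ℚ * x - 0ℚ + 0ℚ * y) * t
    lemma = solve-∀ ring
  G-riemann {t} 0≤t (suc e) e<n = ≤-trans
    (step₁ (fromℕ e) (G t e) (B² (X t 1)) (B² x) (B² (x + z * x)) (floorℚ x) x W t
      (G-riemann 0≤t e (ℕₚ.<⇒≤ e<n))
      (B²-increment x (0≤z ⊗ X-nonNeg 0≤t (suc e)))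
      (X-nonNeg 0≤t (suc e)) (floor-≤ x) (^-antitone 0≤w w≤1 e<n) (X-* t (suc e)))
    (≡⇒≤ (cong₂ (λ K D → (K * (z * t) - (D + G t e) + K * (z * z * t)) * (t * (+ 2 // 1)))
      (sym (fromℕ-suc e)) (sym (dbf-short 0≤t (suc e)))))
    where
    x = X t (suc e)
    W = w ^ suc e
    step₁ : ∀ K G b₁ b b′ F x W t → a * a * (b - b₁)
      ≤ (K * (z * t) - G + K * (z * z * t)) * (t * (+ 2 // 1)) →
      b′ ≤ b + (z * x * (x - F) + z * x * (z * x)) * (+ 2 // 1) → 0ℚ ≤ x → F ≤ x → a ≤ W → x * W ≡ t →
      a * a * (b′ - b₁) ≤ ((1ℚ + K) * (z * t) - (F * (z * W) + G)
        + (1ℚ + K) * (z * z * t)) * (t * (+ 2 // 1))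
    step₁ K G b₁ b b′ F x W t ih inc 0≤x F≤x a≤W refl =
      core a z K G b₁ b b′ F x W 0≤a 0≤z ih inc 0≤x F≤x a≤W
      where
      core : ∀ a z K G b₁ b b′ F x W → 0ℚ ≤ a → 0ℚ ≤ z →
        a * a * (b - b₁) ≤ (K * (z * (x * W)) - G + K * (z * z * (x * W))) * (x * W * (+ 2 // 1)) →
        b′ ≤ b + (z * x * (x - F) + z * x * (z * x)) * (+ 2 // 1) → 0ℚ ≤ x → F ≤ x → a ≤ W →
        a * a * (b′ - b₁) ≤ ((1ℚ + K) * (z * (x * W)) - (F * (z * W) + G)
          + (1ℚ + K) * (z * z * (x * W))) * (x * W * (+ 2 // 1))
      core a z K G b₁ b b′ F x W 0≤a 0≤z ih inc 0≤x F≤x a≤W = ≤-from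
        ( gap ih
        ⊕ 0≤a ⊗ 0≤a ⊗ gap inc
        ⊕ (gap a≤W ⊗ (0≤a ⊕ ≤-trans 0≤a a≤W)) ⊗ ((0≤z ⊗ 0≤x ⊗ gap F≤x ⊕ 0≤z ⊗ 0≤x ⊗ (0≤z ⊗ 0≤x)) ⊗ ≥0
          (+ 2 // 1)))
        (solve (a ∷ z ∷ K ∷ G ∷ b₁ ∷ b ∷ b′ ∷ F ∷ x ∷ W ∷ []) ring)

  -- By superadditivity and linear growth, `B²` increases by at least `β * L` along the grid. As a L
  -- = (1 - a) X₁ and X₁ ≥ t, the shortfall a² β L / (2t) is at least a (1 - a)².
  G-late : ∀ {t} → a * (+ 2 // 1) ≤ t →
    G t n ≤ y * t - a * ((1ℚ - a) * (1ℚ - a)) + y * (z * t)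
  G-late {t} 2a≤t = cancel-*-≤ {r = t * (+ 2 // 1)} (t>0 ⊗₊ >0 (+ 2 // 1))
    (core a z (fromℕ n) (G t n) t (B² Xₙ₊₁ - B² X₁) X₁ X₁≥t 0≤a a≤1 (G-riemann 0≤t n ℕₚ.≤-refl) growth)
    where
    t>0 : 0ℚ < t
    t>0 = <-≤-trans (a>0 ⊗₊ >0 (+ 2 // 1)) 2a≤t
    0≤t = <⇒≤ t>0
    a≤1 = w^≤1 n
    X₁ = X t 1
    Xₙ₊₁ = X t (suc n)
    X₁≥t : t ≤ X₁
    X₁≥t = ≤-from (0≤z ⊗ 0≤t) refl
    aX : Xₙ₊₁ * a ≡ X₁
    aX = cancel-*-≡ w>0 (trans (lemma Xₙ₊₁ a w) (trans (X-* t (suc n))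
      (trans (sym (X-* t 1)) (cong (_*_ X₁) (*-identityʳ w)))))
      where
      lemma : ∀ x a w → x * a * w ≡ x * (w * a)
      lemma = solve-∀ ring
    -- `L` is the length of the grid, X₁ (1 - a)/a, and `β` is a lower bound for it that comes from
    -- X₁ ≥ t ≥ 2a.
    β L : ℚ
    β = (1ℚ - a) * (+ 2 // 1)
    L = Xₙ₊₁ - X₁
    aL : L * a ≡ X₁ * (1ℚ - a)
    aL = trans (lemma Xₙ₊₁ a X₁) (trans (cong (_- X₁ * a) aX) (lemma′ X₁ a))
      where
      lemma : ∀ x a y → (x - y) * a ≡ x * a - y * a
      lemma = solve-∀ ring
      lemma′ : ∀ x a → x - x * a ≡ x * (1ℚ - a)
      lemma′ = solve-∀ ring
    β≤L : β ≤ L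
    β≤L = cancel-*-≤ a>0 (≤-trans (lemma a t X₁ 2a≤t X₁≥t a≤1) (≡⇒≥ aL))
      where
      lemma : ∀ a t x → a * (+ 2 // 1) ≤ t → t ≤ x → a ≤ 1ℚ → (1ℚ - a) * (+ 2 // 1) * a ≤ x * (1ℚ - a)
      lemma a t x h₁ h₂ h₃ = ≤-from ((gap h₁ ⊕ gap h₂) ⊗ gap h₃) (solve (a ∷ t ∷ x ∷ []) ring)
    -- Here a ≥ 5/8 puts `β` exactly into the range of `B²-linear`.
    β≤¾ : β ≤ + 3 // 4
    β≤¾ = lemma a a≥
      where
      lemma : ∀ a → + 5 // 8 ≤ a → (1ℚ - a) * (+ 2 // 1) ≤ + 3 // 4
      lemma a h = ≤-from (gap h ⊗ ≥0 (+ 2 // 1)) (solve (a ∷ []) ring)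
    growth : (1ℚ - a) * (+ 2 // 1) * (X₁ * (1ℚ - a)) ≤ (B² Xₙ₊₁ - B² X₁) * a
    growth = ≤-trans (≡⇒≤ (trans (cong (_*_ β) (sym aL)) (sym (*-assoc β L a))))
      (*-monoʳ-≤-nonNeg a {{nonNegative 0≤a}} (≤-trans (B²-linear (gap a≤1 ⊗ ≥0 (+ 2 // 1)) β≤¾ β≤L)
        (lemma (B² X₁) (B² L) (B² Xₙ₊₁) (≤-trans (B²-superadditive X₁ L)
          (≡⇒≤ (cong B² (lemma′ X₁ Xₙ₊₁)))))))
      where
      lemma : ∀ p q r → p + q ≤ r → q ≤ r - p
      lemma p q r h = ≤-from (gap h) (solve (p ∷ q ∷ r ∷ []) ring)
      lemma′ : ∀ x y → x + (y - x) ≡ y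
      lemma′ = solve-∀ ring
    core : ∀ a z N G t b x → t ≤ x → 0ℚ ≤ a → a ≤ 1ℚ →
      a * a * b ≤ (N * (z * t) - G + N * (z * z * t)) * (t * (+ 2 // 1)) →
      (1ℚ - a) * (+ 2 // 1) * (x * (1ℚ - a)) ≤ b * a →
      G * (t * (+ 2 // 1)) ≤ (N * z * t - a * ((1ℚ - a) * (1ℚ - a)) + N * z * (z * t)) * (t * (+ 2 // 1))
    core a z N G t b x t≤x 0≤a a≤1 h₁ h₂ = ≤-from
      (gap h₁ ⊕ 0≤a ⊗ gap h₂ ⊕ 0≤a ⊗ (gap a≤1 ⊗ gap a≤1 ⊗ gap t≤x ⊗ ≥0 (+ 2 // 1)))
      (solve (a ∷ z ∷ N ∷ G ∷ t ∷ b ∷ x ∷ []) ring)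

-- The task set, and its failure under both tests

module Witness {δ : ℚ} (s : Scale δ) where
  open Scale s
  open Construction s

  y>0 : 0ℚ < y
  y>0 = subst (0ℚ <_) (trans (lemma (fromℕ m) z) (cong (_* z) (sym (fromℕ-suc m))))
    ((fromℕ-nonNeg m ⊗ 0≤z) ⊕₊ z>0)
    where
    lemma : ∀ k z → k * z + z ≡ (1ℚ + k) * z
    lemma = solve-∀ ring

  z≤y : z ≤ y
  z≤y = ≤-from (fromℕ-nonNeg m ⊗ 0≤z) (trans (cong (_* z) (fromℕ-suc m)) (lemma (fromℕ m) z))
    where
    lemma : ∀ k z → (1ℚ + k) * z ≡ z + k * z
    lemma = solve-∀ ring

  y≤a : y ≤ a
  y≤a = ≤-trans y≤ (≤-trans (toWitness {a? = (+ 36 // 100) ≤? (+ 5 // 8)} tt) a≥)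

  y≤1 : y ≤ 1ℚ
  y≤1 = ≤-trans y≤a (w^≤1 n)

  -- The short tasks have demand 1 - a at time 1; `c` raises this to `y`.
  c : ℚ
  c = y + a - 1ℚ

  -- The bound 1 - n z ≤ a is strict: its last step lowers the power by at most z w instead of z,
  -- which leaves c ≥ z (1 - w).
  c>0 : 0ℚ < c
  c>0 = subst (λ k → 0ℚ < k * z + a - 1ℚ) (sym (fromℕ-suc m))
    (step z w (w ^ m) (fromℕ m) 0≤z 0≤w (1-kz≤^ 0≤z 0≤w w-eq m) (w^≤1 m) (^-nonNeg 0≤w m) z>0 w<1 w-eq)
    where
    w<1 : w < 1ℚ
    w<1 = <-from (z>0 ⊗₊ w>0) (sym w-eq)
    step : ∀ z w W K → 0ℚ ≤ z → 0ℚ ≤ w → 1ℚ - K * z ≤ W → W ≤ 1ℚ → 0ℚ ≤ W → 0ℚ < z → w < 1ℚ →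
      w + z * w ≡ 1ℚ →
      0ℚ < (1ℚ + K) * z + w * W - 1ℚ
    step z w W K 0≤z 0≤w h W≤1 0≤W z>0 w<1 eq = <-from
      ((gap h ⊕ 0≤z ⊗ 0≤w ⊗ gap W≤1 ⊕ 0≤W ⊗ gap (≡⇒≥ eq)) ⊕₊ (z>0 ⊗₊ gap₊ w<1))
      (solve (z ∷ w ∷ W ∷ K ∷ []) ring)

  longTask lastTask : Task
  longTask = task c ∞ 1ℚ c>0 (>0 1ℚ)
  lastTask = task y ∞ 1ℚ y>0 (>0 1ℚ)

  chain : List Task
  chain = shorts n ++ [ longTask ]

  tasks : ℕ → List Task
  tasks M = spread M chain [ lastTask ]

  z*w^>0 : ∀ e → 0ℚ < z * w ^ e
  z*w^>0 e = z>0 ⊗₊ ^-pos w>0 e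

  interference-≤ : ∀ {t e} → e ℕ.≤ n → t ≤ 1ℚ → interference t (short e) ≤ (+ 2 // 1) * (z * w ^ e)
  interference-≤ {t} {e} e≤n t≤1 = *-monoʳ-≤-nonNeg (z * w ^ e) {{nonNegative (<⇒≤ (z*w^>0 e))}}
    (ι-≤-pred {ceiling x} {+ 2} (<-≤-trans (ceiling<+1 x) (+-monoˡ-≤ 1ℚ x≤2)))
    where
    x = div t (w ^ e) (^-pos w>0 e)
    lemma : ∀ t a W → t ≤ 1ℚ → + 5 // 8 ≤ a → a ≤ W → t ≤ (+ 2 // 1) * W
    lemma t a W h₁ h₂ h₃ = ≤-from (gap h₁ ⊕ gap h₂ ⊗ ≥0 (+ 2 // 1) ⊕ gap h₃ ⊗ ≥0 (+ 2 // 1) ⊕ ≥0 (+ 1 // 4))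
      (solve (t ∷ a ∷ W ∷ []) ring)
    x≤2 : x ≤ + 2 // 1
    x≤2 = div-≤ (^-pos w>0 e) (lemma t a (w ^ e) t≤1 a≥ (^-antitone 0≤w w≤1 e≤n))

  interference-≥ : ∀ {t e} k → ι k * w ^ e < t → (ι k + 1ℚ) * (z * w ^ e) ≤ interference t (short e)
  interference-≥ {t} {e} k kW<t = *-monoʳ-≤-nonNeg (z * w ^ e) {{nonNegative (<⇒≤ (z*w^>0 e))}}
    (≤-trans (≡⇒≥ (ι-suc k)) (ι-≤-pred {k ℤ.+ + 1} {ceiling x}
      (≤-<-trans (≡⇒≤ (ι-suc k)) (+-monoˡ-< 1ℚ (<-≤-trans k<x (≤-ceiling x))))))
    where
    x = div t (w ^ e) (^-pos w>0 e)
    k<x : ι k < x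
    k<x = *-cancelʳ-<-nonNeg (w ^ e) {{nonNegative (^-nonNeg 0≤w e)}}
      (<-≤-trans kW<t (≡⇒≥ (div-* t (w ^ e) (^-pos w>0 e))))

  -- Up to time 1 each short task interferes with at most two jobs, whose costs telescope to 2 (wᵉ -
  -- a). Every task passes at its own deadline: a short one because wᵉ ≤ 1 ≤ 2a, the long one
  -- because y ≤ a.
  passes-TDA : ∀ e L → e ℕ.≤ n →
    (∀ t → t ≤ 1ℚ → sumQ (map (interference t) L) ≤ (+ 2 // 1) * (w ^ e - a)) →
    Passes TDA L (shorts e ++ [ longTask ])
  passes-TDA zero L _ inv = (1ℚ , >0 1ℚ , ≤-refl , step y a _ y≤a (inv 1ℚ ≤-refl)) , tt
    where
    step : ∀ y a S → y ≤ a → S ≤ (+ 2 // 1) * (1ℚ - a) → y + a - 1ℚ + S ≤ 1ℚ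
    step y a S h₁ h₂ = ≤-from (gap h₁ ⊕ gap h₂) (solve (y ∷ a ∷ S ∷ []) ring)
  passes-TDA (suc e) L e<n inv =
    (W , ^-pos w>0 (suc e) , ≤-refl , step z a W (w ^ e) _ (inv W (w^≤1 (suc e))) (w^-suc e) (w^≤1 e) a≥) ,
    passes-TDA e (L ++ [ short (suc e) ]) (ℕₚ.<⇒≤ e<n) λ t t≤1 →
      ≤-trans (≡⇒≤ (sumQ-snoc (interference t) L (short (suc e))))
        (≤-trans (+-mono-≤ (inv t t≤1) (interference-≤ {t} {suc e} e<n t≤1))
          (next z a W (w ^ e) (w^-suc e)))
    where
    W = w ^ suc e
    step : ∀ z a W V S → S ≤ (+ 2 // 1) * (W - a) → W + z * W ≡ V → V ≤ 1ℚ → + 5 // 8 ≤ a → z * W + S ≤ W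
    step z a W V S h eq h₁ h₂ = ≤-from
      (gap h ⊕ gap (≡⇒≤ eq) ⊕ gap h₁ ⊕ gap h₂ ⊗ ≥0 (+ 2 // 1) ⊕ ≥0 (+ 1 // 4))
      (solve (z ∷ a ∷ W ∷ V ∷ S ∷ []) ring)
    next : ∀ z a W V → W + z * W ≡ V → (+ 2 // 1) * (W - a) + (+ 2 // 1) * (z * W) ≤ (+ 2 // 1) * (V - a)
    next z a W V eq = ≤-from (≥0 (+ 2 // 1) ⊗ gap (≡⇒≤ eq)) (solve (z ∷ a ∷ W ∷ V ∷ []) ring)

  -- The first jobs alone contribute 1 - wᵉ. The tasks with period below `t` have a second job, and
  -- these contribute at least t - wᵉ more. The first bound carries the induction while the current
  -- period is still at least `t`.
  interference-shorts : ∀ {t} → 0ℚ < t → t ≤ 1ℚ → ∀ e →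
    let S = sumQ (map (interference t) (shorts e)) in
    1ℚ - w ^ e ≤ S × 1ℚ - w ^ e + (t - w ^ e) ≤ S
  interference-shorts {t} t>0 t≤1 zero = ≤-refl , lemma t t≤1
    where
    lemma : ∀ t → t ≤ 1ℚ → 1ℚ - 1ℚ + (t - 1ℚ) ≤ 0ℚ
    lemma t h = ≤-from (gap h) (solve (t ∷ []) ring)
  interference-shorts {t} t>0 t≤1 (suc e)
    = first , second
    where
    ih₁ = proj₁ (interference-shorts t>0 t≤1 e)
    ih₂ = proj₂ (interference-shorts t>0 t≤1 e)
    W = w ^ suc e
    S = sumQ (map (interference t) (shorts e))
    one : (0ℚ + 1ℚ) * (z * W) ≤ interference t (short (suc e))
    one = interference-≥ {t} {suc e} (+ 0) (≤-<-trans (≡⇒≤ (*-zeroˡ W)) t>0)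
    step₁ : ∀ z W V S I → (0ℚ + 1ℚ) * (z * W) ≤ I → 1ℚ - V ≤ S → W + z * W ≡ V → 1ℚ - W ≤ I + S
    step₁ z W V S I h ih eq = ≤-from (gap h ⊕ gap ih ⊕ gap (≡⇒≥ eq)) (solve (z ∷ W ∷ V ∷ S ∷ I ∷ []) ring)
    first : 1ℚ - W ≤ interference t (short (suc e)) + S
    first = step₁ z W (w ^ e) S _ one ih₁ (w^-suc e)
    second : 1ℚ - W + (t - W) ≤ interference t (short (suc e)) + S
    second with W <? t
    ... | yes W<t = step₂ t z W (w ^ e) S _ (interference-≥ {t} {suc e} (+ 1)
        (≤-<-trans (≡⇒≤ (*-identityˡ W)) W<t)) ih₂ (w^-suc e)
      where
      step₂ : ∀ t z W V S I → (1ℚ + 1ℚ) * (z * W) ≤ I → 1ℚ - V + (t - V) ≤ S → W + z * W ≡ V →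
        1ℚ - W + (t - W) ≤ I + S
      step₂ t z W V S I h ih eq = ≤-from (gap h ⊕ gap ih ⊕ gap (≡⇒≥ eq) ⊕ gap (≡⇒≥ eq))
        (solve (t ∷ z ∷ W ∷ V ∷ S ∷ I ∷ []) ring)
    ... | no W≮t = ≤-trans (lemma t W (≮⇒≥ W≮t)) first
      where
      lemma : ∀ t W → t ≤ W → 1ℚ - W + (t - W) ≤ 1ℚ - W
      lemma t W h = ≤-from (gap h) (solve (t ∷ W ∷ []) ring)

  ¬TDA : ¬ TDA chain lastTask
  ¬TDA (t , t>0 , t≤1 , h) =
    <-irrefl refl (<-≤-trans (step y a t _ (proj₂ (interference-shorts t>0 t≤1 n)) above)
    (≤-trans (≡⇒≥ (cong (_+_ y) (sumQ-snoc (interference t) (shorts n) longTask))) h))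
    where
    step : ∀ y a t S → 1ℚ - a + (t - a) ≤ S → a < y * (+ 2 // 1) → t < y + (S + (y + a - 1ℚ))
    step y a t S h₁ h₂ = <-from (gap h₁ ⊕₊ gap₊ h₂) (solve (y ∷ a ∷ t ∷ S ∷ []) ring)

  fails-TDA : ∀ M .{{_ : NonZero M}} → DMPFails TDA M (tasks M)
  fails-TDA M = DMPFails-spread (short n) (shorts m ++ [ longTask ]) M (proj₁ passes) (proj₂ passes) ¬TDA
    where
    lemma : ∀ a → 0ℚ ≡ (+ 2 // 1) * (a - a)
    lemma = solve-∀ ring
    passes = passes-TDA n [] ℕₚ.≤-refl (λ _ _ → ≡⇒≤ (lemma a))

  long-C U+1 : ℚ → Task → ℚ
  long-C D τ = if longPeriod D τ then C τ else 0ℚ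
  U+1 D τ = if longPeriod D τ then 1ℚ else U τ + 1ℚ

  U-short : ∀ e → U (short e) ≡ z
  U-short e = div-unique (^-pos w>0 e) refl

  module _ {D : ℚ} {e : ℕ} (short<D : w ^ e < D) where

    not-long : longPeriod D (short e) ≡ false
    not-long = ≰⇒≤ᵇ-false (λ le → <-irrefl refl (<-≤-trans short<D le))

    long-C-short : long-C D (short e) ≡ 0ℚ
    long-C-short = cong (λ b → if b then C (short e) else 0ℚ) not-long

    U+1-short : U+1 D (short e) ≡ z + 1ℚ
    U+1-short = trans (cong (λ b → if b then 1ℚ else U (short e) + 1ℚ) not-long) (cong (_+ 1ℚ) (U-short e))

  w^-suc-< : ∀ e → w ^ suc e < w ^ e
  w^-suc-< e = <-from (z*w^>0 (suc e)) (sym (w^-suc e))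

  -- L holds the tasks short n, …, short (e + 1).
  HypInv : ℕ → List Task → Set
  HypInv e L = ∀ D → w ^ e ≤ D → sumQ (map (long-C D) L) ≡ 0ℚ × prodQ (map (U+1 D) L) * a ≡ w ^ e

  hypInv-snoc : ∀ e L → HypInv (suc e) L → HypInv e (L ++ [ short (suc e) ])
  hypInv-snoc e L inv D w^e≤D =
    trans (sumQ-snoc (long-C D) L (short (suc e)))
      (trans (cong₂ _+_ s≡ (long-C-short {D} {suc e} <D)) (+-identityˡ 0ℚ)) ,
    trans (cong (_* a) (trans (prodQ-snoc (U+1 D) L (short (suc e)))
      (cong (_*_ (prodQ (map (U+1 D) L))) (U+1-short {D} {suc e} <D))))
      (trans (lemma (prodQ (map (U+1 D) L)) z a) (trans (cong (λ V → V + z * V) p≡) (w^-suc e)))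
    where
    s≡ = proj₁ (inv D (≤-trans (<⇒≤ (w^-suc-< e)) w^e≤D))
    p≡ = proj₂ (inv D (≤-trans (<⇒≤ (w^-suc-< e)) w^e≤D))
    <D : w ^ suc e < D
    <D = <-≤-trans (w^-suc-< e) w^e≤D
    lemma : ∀ p z a → p * (z + 1ℚ) * a ≡ p * a + z * (p * a)
    lemma = solve-∀ ring

  hypInv-shorts : ∀ e L → HypInv e L → HypInv 0 (L ++ shorts e)
  hypInv-shorts zero    L inv = subst (HypInv 0) (sym (++-identityʳ L)) inv
  hypInv-shorts (suc e) L inv = subst (HypInv 0) (++-assoc L [ short (suc e) ] (shorts e))
    (hypInv-shorts e (L ++ [ short (suc e) ]) (hypInv-snoc e L inv))

  hypInv-[] : HypInv n []
  hypInv-[] D _ = refl , *-identityˡ a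

  -- Both sides of the test are multiplied by `a`, which turns the product of factors 1 + z into a
  -- power of `w`.
  hyperbolic-intro : ∀ L τ Uτ V → sumQ (map (long-C (D τ)) L) ≡ 0ℚ → div (C τ) (D τ) (D>0 τ) ≡ Uτ →
    prodQ (map (U+1 (D τ)) L) * a ≡ V → (Uτ + 1ℚ) * V ≤ (+ 2 // 1) * a → Hyperbolic L τ
  hyperbolic-intro L τ Uτ V s≡ refl refl h = cancel-*-≤ a>0 (≤-trans (≡⇒≤
    (trans (cong (λ q → (div q (D τ) (D>0 τ) + 1ℚ) * prodQ (map (U+1 (D τ)) L) * a)
      (trans (cong (_+_ (C τ)) s≡) (+-identityʳ (C τ))))
      (*-assoc (div (C τ) (D τ) (D>0 τ) + 1ℚ) _ a))) h)

  div-1 : ∀ {p} (h : 0ℚ < 1ℚ) → div p 1ℚ h ≡ p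
  div-1 {p} h = div-unique h (*-identityʳ p)

  -- Multiplied by `a`, the test reads wᵉ ≤ 2a for a short task and y + a ≤ 2a for the long one.
  passes-Hyperbolic : ∀ e L → e ℕ.≤ n → HypInv e L → Passes Hyperbolic L (shorts e ++ [ longTask ])
  passes-Hyperbolic zero L _ inv =
    hyperbolic-intro L longTask c 1ℚ (proj₁ (inv 1ℚ ≤-refl)) (div-1 (>0 1ℚ)) (proj₂ (inv 1ℚ ≤-refl))
      (step y a y≤a) , tt
    where
    step : ∀ y a → y ≤ a → (y + a - 1ℚ + 1ℚ) * 1ℚ ≤ (+ 2 // 1) * a
    step y a h = ≤-from (gap h) (solve (y ∷ a ∷ []) ring)
  passes-Hyperbolic (suc e) L e<n inv =
    hyperbolic-intro L (short (suc e)) z (w ^ suc e) (proj₁ (inv (w ^ suc e) ≤-refl)) (U-short (suc e))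
      (proj₂ (inv (w ^ suc e) ≤-refl)) (step z a (w ^ suc e) (w ^ e) (w^-suc e) (w^≤1 e) a≥) ,
    passes-Hyperbolic e (L ++ [ short (suc e) ]) (ℕₚ.<⇒≤ e<n) (hypInv-snoc e L inv)
    where
    step : ∀ z a W V → W + z * W ≡ V → V ≤ 1ℚ → + 5 // 8 ≤ a → (z + 1ℚ) * W ≤ (+ 2 // 1) * a
    step z a W V eq h₁ h₂ = ≤-from (gap (≡⇒≤ eq) ⊕ gap h₁ ⊕ ≥0 (+ 2 // 1) ⊗ gap h₂ ⊕ ≥0 (+ 1 // 4))
      (solve (z ∷ a ∷ W ∷ V ∷ []) ring)

  ¬Hyperbolic : ¬ Hyperbolic chain lastTask
  ¬Hyperbolic h =
    <-irrefl refl (<-≤-trans (step y a above) (≤-trans (≡⇒≥ eq) (*-monoʳ-≤-nonNeg a {{nonNegative 0≤a}} h)))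
    where
    -- At deadline 1 all short tasks count in the product, while the long task, of infinite period,
    -- counts in the sum.
    s≡ = proj₁ (hypInv-shorts n [] hypInv-[] 1ℚ ≤-refl)
    p≡ = proj₂ (hypInv-shorts n [] hypInv-[] 1ℚ ≤-refl)
    Σ = sumQ (map (long-C 1ℚ) chain)
    Π = prodQ (map (U+1 1ℚ) chain)
    Σ≡ : Σ ≡ c
    Σ≡ = trans (sumQ-snoc (long-C 1ℚ) (shorts n) longTask) (trans (cong (_+ c) s≡) (+-identityˡ c))
    Π≡ : Π * a ≡ 1ℚ
    Π≡ = trans (cong (_* a) (trans (prodQ-snoc (U+1 1ℚ) (shorts n) longTask)
      (*-identityʳ (prodQ (map (U+1 1ℚ) (shorts n)))))) p≡
    eq : (div (y + Σ) 1ℚ (>0 1ℚ) + 1ℚ) * Π * a ≡ y + c + 1ℚ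
    eq = trans (*-assoc (div (y + Σ) 1ℚ (>0 1ℚ) + 1ℚ) Π a)
      (trans (cong₂ _*_ (cong (_+ 1ℚ) (trans (div-1 (>0 1ℚ)) (cong (_+_ y) Σ≡))) Π≡)
        (*-identityʳ (y + c + 1ℚ)))
    step : ∀ y a → a < y * (+ 2 // 1) → (+ 2 // 1) * a < y + (y + a - 1ℚ) + 1ℚ
    step y a h = <-from (gap₊ h) (solve (y ∷ a ∷ []) ring)

  fails-Hyperbolic : ∀ M .{{_ : NonZero M}} → DMPFails Hyperbolic M (tasks M)
  fails-Hyperbolic M = DMPFails-spread (short n) (shorts m ++ [ longTask ]) M (proj₁ passes) (proj₂ passes)
    ¬Hyperbolic
    where
    passes = passes-Hyperbolic n [] ℕₚ.≤-refl hypInv-[]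

-- Deadline order and the bound on Λ

module Bounds {δ : ℚ} (s : Scale δ) where
  open Scale s
  open Construction s
  open Witness s

  sorted : ∀ M .{{_ : NonZero M}} → SortedByDeadline (tasks M)
  sorted M = spread-sorted M (short n) (shorts m ++ [ longTask ]) (sorted-from m)
    where
    sorted-from : ∀ e → SortedByDeadline (short (suc e) ∷ ((shorts e ++ [ longTask ]) ++ [ lastTask ]))
    sorted-from zero    = w^≤1 1 Linked.∷ ≤-refl Linked.∷ Linked.[-]
    sorted-from (suc e) = <⇒≤ (w^-suc-< (suc e)) Linked.∷ sorted-from e

  tasks-All : ∀ {P : Task → Set} M → (∀ e → P (short e)) → P longTask → P lastTask → All P (tasks M)
  tasks-All {P} M ps pl pf =
    spread-All M chain (Allₚ.++⁺ (Allₚ.++⁺ (all-shorts n) (pl All.∷ All.[])) (pf All.∷ All.[]))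
    where
    all-shorts : ∀ e → All P (shorts e)
    all-shorts zero    = All.[]
    all-shorts (suc e) = ps (suc e) All.∷ all-shorts e

  constrained : ∀ M → All Constrained (tasks M)
  constrained M = tasks-All M (λ _ → ≤-refl) tt tt

  -- m z / (1 + z), just below y, lies below W(1/2).
  x₀ : ℚ
  x₀ = fromℕ m * (z * w)

  x₀≥0 : 0ℚ ≤ x₀
  x₀≥0 = fromℕ-nonNeg m ⊗ (0≤z ⊗ 0≤w)

  -- As 1 - z w = w, the exponential of `x₀` is at most w⁻ᵐ, while x₀ ≤ m z ≤ wᵐ / 2 by the choice
  -- of `m`.
  x₀≤W½ : ∀ k → x₀ * expPartial x₀ k ≤ ½
  x₀≤W½ k = step (fromℕ m) z w (w ^ m) (expPartial x₀ k) below E-bound (expPartial-nonNeg x₀≥0 k)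
    (fromℕ-nonNeg m) 0≤z w≤1
    where
    zw≤1 : z * w ≤ 1ℚ
    zw≤1 = ≤-from 0≤w (trans (sym w-eq) (+-comm w (z * w)))
    1-zw : 1ℚ - z * w ≡ w
    1-zw = trans (cong (λ q → q - z * w) (sym w-eq)) (lemma w (z * w))
      where
      lemma : ∀ a b → a + b - b ≡ a
      lemma = solve-∀ ring
    E-bound : expPartial x₀ k * w ^ m ≤ 1ℚ
    E-bound = subst (λ q → expPartial x₀ k * q ^ m ≤ 1ℚ) 1-zw (expPartial-*-^ (0≤z ⊗ 0≤w) zw≤1 k m)
    step : ∀ K z w W E → K * z * (+ 2 // 1) ≤ W → E * W ≤ 1ℚ → 0ℚ ≤ E → 0ℚ ≤ K → 0ℚ ≤ z → w ≤ 1ℚ →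
      K * (z * w) * E ≤ ½
    step K z w W E h₁ h₂ 0≤E 0≤K 0≤z w≤1 = ≤-from
      (≥0 ½ ⊗ gap h₂ ⊕ ≥0 ½ ⊗ 0≤E ⊗ gap h₁ ⊕ 0≤K ⊗ 0≤z ⊗ 0≤E ⊗ gap w≤1)
      (solve (K ∷ z ∷ w ∷ W ∷ E ∷ []) ring)

  -- The crossing is tight: going from `m` to `n` raises 2y by 2z and lowers the power by at most z.
  2y≤a+3z : y * (+ 2 // 1) ≤ a + (+ 3 // 1) * z
  2y≤a+3z = subst (λ k → k * z * (+ 2 // 1) ≤ a + (+ 3 // 1) * z) (sym (fromℕ-suc m))
    (step (fromℕ m) z a (w ^ m) below (w^-suc m) (w^≤1 n) 0≤z)
    where
    step : ∀ K z a W → K * z * (+ 2 // 1) ≤ W → a + z * a ≡ W → a ≤ 1ℚ → 0ℚ ≤ z →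
      (1ℚ + K) * z * (+ 2 // 1) ≤ a + (+ 3 // 1) * z
    step K z a W h eq h′ 0≤z = ≤-from (gap h ⊕ gap (≡⇒≥ eq) ⊕ 0≤z ⊗ gap h′)
      (solve (K ∷ z ∷ a ∷ W ∷ []) ring)

  dbf-long-≤ : ∀ {x} (x>0 : 0ℚ < x) t → dbf (task x ∞ 1ℚ x>0 (>0 1ℚ)) t ≤ x
  dbf-long-≤ x>0 t with 1ℚ ≤ᵇ t
  ... | true  = ≤-refl
  ... | false = <⇒≤ x>0

  dbf-long-≡0 : ∀ {x} (x>0 : 0ℚ < x) {t} → ¬ 1ℚ ≤ t → dbf (task x ∞ 1ℚ x>0 (>0 1ℚ)) t ≡ 0ℚ
  dbf-long-≡0 {x} _ t<1 = cong (λ b → if b then x else 0ℚ) (≰⇒≤ᵇ-false t<1)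

  module _ {γ : ℚ} (M : ℕ) .{{_ : NonZero M}} (γ-bound : (+ 5 // 1) * z + (+ 1 // M) ≤ γ) where

    v : ℚ
    v = + 1 // M

    0≤v : 0ℚ ≤ v
    0≤v = <⇒≤ (1/n>0 M)

    bound : ℚ
    bound = y + ((+ 3 // 1) * z + v)

    -- `y` exceeds `x₀` by at most 3z/2, so the 5z reserved in `γ-bound` covers this together with
    -- the 3z in `bound`.
    W½-bound : ∀ {x} → x ≤ bound → ≤W½+ γ x
    W½-bound {x} x≤ = ≤W½+-intro {γ} {x} x₀≥0 x₀≤W½
      (step x (fromℕ m) z w v γ (≤-trans x≤ (≡⇒≤ (cong (λ k → k * z + ((+ 3 // 1) * z + v)) (fromℕ-suc m))))
        γ-bound mz≤1 w≤1 w-eq 0≤z 0≤w (fromℕ-nonNeg m))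
      where
      mz≤1 : fromℕ m * z * (+ 2 // 1) ≤ 1ℚ
      mz≤1 = ≤-trans below (w^≤1 m)
      step : ∀ x K z w v γ → x ≤ (1ℚ + K) * z + ((+ 3 // 1) * z + v) → (+ 5 // 1) * z + v ≤ γ →
        K * z * (+ 2 // 1) ≤ 1ℚ →
        w ≤ 1ℚ → w + z * w ≡ 1ℚ → 0ℚ ≤ z → 0ℚ ≤ w → 0ℚ ≤ K → x - γ ≤ K * (z * w)
      step x K z w v γ h₁ h₂ h₃ h₄ eq 0≤z 0≤w 0≤K = ≤-from
        ( gap h₁ ⊕ gap h₂ ⊕ ≥0 ½ ⊗ 0≤z ⊗ 0≤w ⊗ gap h₃ ⊕ ≥0 ½ ⊗ 0≤z ⊗ gap h₄ ⊕ ≥0 ½ ⊗ 0≤z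
        ⊕ 0≤K ⊗ 0≤z ⊗ gap (≡⇒≥ eq))
        (solve (x ∷ K ∷ z ∷ w ∷ v ∷ γ ∷ []) ring)

    -- The `M` copies cancel the division by `M`; only the single last task keeps the weight `v`.
    average : ∀ (f : Task → ℚ) → sumQ (map f (tasks M)) * v
      ≡ sumQ (map f (shorts n)) + f longTask + v * f lastTask
    average f = trans (cong (_* v) (spread-sum f M chain [ lastTask ]))
      (trans (lemma (fromℕ M) (sumQ (map f chain)) (f lastTask) v)
        (trans (cong (λ q → q * sumQ (map f chain) + v * f lastTask) (ι-1/ M))
          (cong (λ q → q + v * f lastTask) (trans (*-identityˡ _) (sumQ-snoc f (shorts n) longTask)))))
      where
      lemma : ∀ M S r v → (M * S + (r + 0ℚ)) * v ≡ M * v * S + v * r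
      lemma = solve-∀ ring

    U-sum : ∀ e → sumQ (map U (shorts e)) ≡ fromℕ e * z
    U-sum zero    = sym (*-zeroˡ z)
    U-sum (suc e) = trans (cong₂ _+_ (U-short (suc e)) (U-sum e))
      (trans (lemma z (fromℕ e)) (cong (_* z) (sym (fromℕ-suc e))))
      where
      lemma : ∀ z k → z + k * z ≡ (1ℚ + k) * z
      lemma = solve-∀ ring

    y≤bound : y ≤ bound
    y≤bound = ≤-from (≥0 (+ 3 // 1) ⊗ 0≤z ⊕ 0≤v) refl

    utilisation : ≤W½+ γ (sumQ (map U (tasks M)) * v)
    utilisation = W½-bound
      (≤-trans (≡⇒≤ (trans (average U) (trans (cong (λ q → q + 0ℚ + v * 0ℚ) (U-sum n)) (lemma y v))))
        y≤bound)
      where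
      lemma : ∀ y v → y + 0ℚ + v * 0ℚ ≡ y
      lemma = solve-∀ ring

    c≤y : c ≤ y
    c≤y = lemma y a (w^≤1 n)
      where
      lemma : ∀ y a → a ≤ 1ℚ → y + a - 1ℚ ≤ y
      lemma y a h = ≤-from (gap h) (solve (y ∷ a ∷ []) ring)

    densities : All (λ τ → ≤W½+ γ (Δ τ)) (tasks M)
    densities = tasks-All M
      (λ e → density (short e) (≤-trans (≡⇒≤ (U-short e)) z≤y) (≤-trans (≡⇒≤ (U-short e)) z≤y))
      (density longTask (<⇒≤ y>0) (≤-trans (≡⇒≤ (div-1 (>0 1ℚ))) c≤y))
      (density lastTask (<⇒≤ y>0) (≡⇒≤ (div-1 (>0 1ℚ))))
      where
      density : ∀ τ → U τ ≤ y → div (C τ) (D τ) (D>0 τ) ≤ y → ≤W½+ γ (Δ τ)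
      density τ h₁ h₂ = W½-bound (≤-trans (⊔-lub h₁ h₂) y≤bound)

    demand-≤ : ∀ {t} → 0ℚ < t → G t n + dbf longTask t + v * dbf lastTask t ≤ bound * t
    demand-≤ {t} t>0 with 1ℚ ≤? t
    ... | no t<1 = ≤-trans
        (≡⇒≤ (cong₂ (λ p q → G t n + p + v * q) (dbf-long-≡0 c>0 {t} t<1) (dbf-long-≡0 y>0 {t} t<1)))
      (step (fromℕ n) z t (G t n) v (G-≤ (<⇒≤ t>0) n) 0≤z 0≤v (<⇒≤ t>0))
      where
      step : ∀ N z t G v → G ≤ N * (z * t) → 0ℚ ≤ z → 0ℚ ≤ v → 0ℚ ≤ t →
        G + 0ℚ + v * 0ℚ ≤ (N * z + ((+ 3 // 1) * z + v)) * t
      step N z t G v h 0≤z 0≤v 0≤t = ≤-from (gap h ⊕ (≥0 (+ 3 // 1) ⊗ 0≤z ⊕ 0≤v) ⊗ 0≤t)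
        (solve (N ∷ z ∷ t ∷ G ∷ v ∷ []) ring)
    ... | yes 1≤t = ≤-trans (+-mono-≤ (+-monoʳ-≤ (G t n) (dbf-long-≤ c>0 t))
        (*-monoˡ-≤-nonNeg v {{nonNegative 0≤v}} (dbf-long-≤ y>0 t)))
        (from-1 (t <? a * (+ 2 // 1)))
      where
      -- The short tasks and the long task together demand at most 1 - a + c = y, which is at most y
      -- t.
      early : ∀ y a z t v G → G ≤ 1ℚ - a → 1ℚ ≤ t → 0ℚ ≤ y → y ≤ 1ℚ → 0ℚ ≤ z → 0ℚ ≤ v →
        G + (y + a - 1ℚ) + v * y ≤ (y + ((+ 3 // 1) * z + v)) * t
      early y a z t v G h 1≤t 0≤y y≤1 0≤z 0≤v = ≤-from
        (gap h ⊕ (0≤y ⊕ 0≤v) ⊗ gap 1≤t ⊕ 0≤v ⊗ gap y≤1 ⊕ ≥0 (+ 3 // 1) ⊗ 0≤z ⊗ (≥0 1ℚ ⊕ gap 1≤t))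
        (solve (y ∷ a ∷ z ∷ t ∷ v ∷ G ∷ []) ring)
      -- The certificate uses a (1 − a)² − (3a/2 − 1) = (2 − a)(1/2 − a²).
      late : ∀ y a z t v G → G ≤ y * t - a * ((1ℚ - a) * (1ℚ - a)) + y * (z * t) → 1ℚ ≤ t → 0ℚ ≤ y →
        y ≤ 1ℚ → 0ℚ ≤ z → 0ℚ ≤ v →
        y * (+ 2 // 1) ≤ a + (+ 3 // 1) * z → a * a ≤ ½ → a ≤ 1ℚ →
        G + (y + a - 1ℚ) + v * y ≤ (y + ((+ 3 // 1) * z + v)) * t
      late y a z t v G h 1≤t 0≤y y≤1 0≤z 0≤v h₁ h₂ h₃ = ≤-from
        ( gap h ⊕ 0≤z ⊗ (≥0 1ℚ ⊕ gap 1≤t) ⊗ gap y≤1 ⊕ 0≤v ⊗ gap 1≤t ⊕ 0≤v ⊗ gap y≤1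
        ⊕ ≥0 ½ ⊗ gap h₁ ⊕ (≥0 1ℚ ⊕ gap h₃) ⊗ gap h₂ ⊕ ≥0 ½ ⊗ 0≤z ⊕ ≥0 (+ 2 // 1) ⊗ 0≤z ⊗ gap 1≤t)
        (solve (y ∷ a ∷ z ∷ t ∷ v ∷ G ∷ []) ring)
      from-1 : Dec (t < a * (+ 2 // 1)) → G t n + c + v * y ≤ bound * t
      from-1 (yes t<2a) = early y a z t v (G t n) (G-early (<⇒≤ t>0) t<2a n ℕₚ.≤-refl) 1≤t (<⇒≤ y>0) y≤1 0≤z
        0≤v
      from-1 (no t≮2a) = late y a z t v (G t n) (G-late (≮⇒≥ t≮2a)) 1≤t (<⇒≤ y>0) y≤1 0≤z 0≤v 2y≤a+3z a²≤½
        (w^≤1 n)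

    Λ-bound : ΛBound γ M (tasks M)
    Λ-bound = demand , utilisation , densities
      where
      demand : (t : ℚ) (h : 0ℚ < t) → ≤W½+ γ (div (sumQ (map (λ τ → dbf τ t) (tasks M)) * v) t h)
      demand t h = W½-bound (div-≤ h (≤-trans (≡⇒≤ (average (λ τ → dbf τ t))) (demand-≤ h)))

-- Choice of the parameters for given γ

-- A positive rational has numerator at least 1.
1/den-≤ : ∀ γ → 0ℚ < γ → + 1 // ℚ.denominatorℕ γ ≤ γ
1/den-≤ γ@(mkℚ (+ suc k) d-1 _) _ = toℚᵘ-cancel-≤ (ℚᵘₚ.≤-respˡ-≃ (ℚᵘₚ.≃-sym (toℚᵘ-fromℚᵘ (mkℚᵘ (+ 1) d-1)))
  (ℚᵘ.*≤* (ℤₚ.*-monoʳ-≤-nonNeg (+ suc d-1) {+ 1} {+ suc k} (ℤ.+≤+ (ℕ.s≤s ℕ.z≤n)))))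
1/den-≤ (mkℚ (+ zero) d-1 _) h = contradiction h (λ { (*<* (ℤ.+<+ ())) })
1/den-≤ (mkℚ -[1+ k ] d-1 _) h = contradiction h (λ { (*<* ()) })

1/-halved : ∀ p M .{{_ : NonZero p}} .{{_ : NonZero M}} → p ℕ.* 2 ℕ.≤ M → + 1 // M ≤ ½ * (+ 1 // p)
1/-halved p M 2p≤M = step (fromℕ p) (fromℕ M) (+ 1 // p) (+ 1 // M)
  (≤-trans (≡⇒≥ (fromℕ-* p 2)) (ι-mono-≤ {+ (p ℕ.* 2)} {+ M} (ℤ.+≤+ 2p≤M)))
  (ι-1/ p) (ι-1/ M) (<⇒≤ (1/n>0 p)) (<⇒≤ (1/n>0 M))
  where
  step : ∀ P M δ v → P * (+ 2 // 1) ≤ M → P * δ ≡ 1ℚ → M * v ≡ 1ℚ → 0ℚ ≤ δ → 0ℚ ≤ v → v ≤ ½ * δ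
  step P M δ v h e₁ e₂ 0≤δ 0≤v = ≤-from
    (≥0 ½ ⊗ 0≤δ ⊗ 0≤v ⊗ gap h ⊕ ≥0 ½ ⊗ 0≤δ ⊗ gap (≡⇒≤ e₂) ⊕ 0≤v ⊗ gap (≡⇒≥ e₁))
    (solve (P ∷ M ∷ δ ∷ v ∷ []) ring)

theorem9 : (γ : ℚ) → 0ℚ < γ →
    ∃[ M₀ ] ((M : ℕ) → M₀ ℕ.≤ M → .{{_ : NonZero M}} →
    ∃[ Ts ] (SortedByDeadline Ts × All Constrained Ts
    × DMPFails TDA M Ts × DMPFails Hyperbolic M Ts
    × ΛBound γ M Ts))
-- With `p` the denominator of `γ`, both 5z and 1/M are at most 1/(2p) once M ≥ 2p, and 1/p ≤ γ. The
-- same task list serves both tests.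
theorem9 γ γ>0 = p ℕ.* 2 , λ M 2p≤M →
  Witness.tasks sc M ,
  Bounds.sorted sc M , Bounds.constrained sc M ,
  Witness.fails-TDA sc M , Witness.fails-Hyperbolic sc M ,
  Bounds.Λ-bound sc M (step (Scale.z sc) (+ 1 // M) (+ 1 // p) γ (Scale.z≤δ sc) (1/-halved p M 2p≤M)
    (1/den-≤ γ γ>0))
  where
  p = ℚ.denominatorℕ γ
  sc = scale p
  step : ∀ z v δ γ → (+ 10 // 1) * z ≤ δ → v ≤ ½ * δ → δ ≤ γ → (+ 5 // 1) * z + v ≤ γ
  step z v δ γ h₁ h₂ h₃ = ≤-from (≥0 ½ ⊗ gap h₁ ⊕ gap h₂ ⊕ gap h₃) (solve (z ∷ v ∷ δ ∷ γ ∷ []) ring)
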